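{- Let $w, s, h, m_1, \ldots, m_s$ be positive integers with $w < h + m_1 + \cdots + m_s$, and let $I(w,s,h,m_1,\ldots,m_s;S,F)$ be a natural inglenook puzzle. Then: (i) if $w>1$, $s>1$, $h>1$ and \[ h-1+m_1+m_2+\cdots+m_s \geq w + \max\{h-1, m_1, m_2, \ldots, m_s\}, \qquad (\ast) \] the puzzle can always be solved; (ii) if $w>1$, $s>2$, $h=1$ and $(\ast)$ holds, the puzzle can always be solved; (iii) if $w=1$, the puzzle can always be solved; (iv) in all other cases, the puzzle cannot always be solved.
   Context: Inglenook puzzle: there are $s$ sidings of lengths $m_1,\ldots,m_s$, a headshunt of length $h$, and a set $W$ of $w$ wagons. A position is a tuple $(W_0,W_1,\ldots,W_s)$ of ordered subsets of $W$ (sequences without repetition) which partition $W$, with $|W_0|\le h$ and $|W_i|\le m_i$ for $1\le i\le s$. Here $W_0$ lists the wagons in the headshunt from shunting engine to points, and $W_i$ lists the wagons in Siding $i$ from points to buffer stop. A move is a pair of distinct positions $(W_0,\ldots,W_s)$, $(W_0',\ldots,W_s')$ such that for some $r\in\{1,\ldots,s\}$ we have $W_i=W_i'$ for all $i\in\{1,\ldots,s\}\setminus\{r\}$, and the concatenation of $W_0$ followed by $W_r$ equals the concatenation of $W_0'$ followed by $W_r'$. The inglenook graph $\Gamma(w,s,h,m_1,\ldots,m_s)$ is the undirected graph whose vertices are positions and whose edges are moves. The puzzle $I(w,s,h,m_1,\ldots,m_s;S,F)$ is specified by a set $S$ of starting positions and a set $F$ of finishing positions; it can always be solved if from every $p\in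 S$ there is a path in the inglenook graph to some position in $F$. The puzzle is natural if (1) $S$ is closed under permuting the wagons (applying any bijection $W\to W$ to the entries of a position in $S$ gives a position in $S$), and (2) there exist $z\in\{1,\ldots,s\}$ and a wagon $\omega\in W$ such that in every finishing position, $\omega$ is the last entry (the wagon nearest the buffer stop) of $W_z$.
   Formalization: The sets S of starting positions and F of finishing positions are assumed nonempty; with S empty the puzzle is vacuously always solvable, against (iv), and with F empty and S nonempty it is never solvable, against (i)–(iii). -}

module Defs where

open import Data.Nat using (ℕ; _+_; _∸_; _⊔_; _≤_; _<_; _>_)
open import Data.Fin using (Fin)
open import Data.Fin.Permutation using (Permutation′; _⟨$⟩ʳ_)
open import Data.List using (List; length; _++_; concat; allFin; last)
import Data.List as L
open import Data.Vec using (Vec; lookup; toList; foldr′; sum)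
import Data.Vec as V
open import Data.List.Relation.Binary.Permutation.Propositional using (_↭_)
open import Data.Maybe using (just)
open import Data.Product using (Σ; _×_; _,_; ∃; ∃-syntax; proj₁; proj₂)
open import Data.Sum using (_⊎_)
open import Relation.Binary.PropositionalEquality using (_≡_; _≢_)
open import Function.Bundles using (_⇔_)

-- A (raw) configuration with wagons Fin w and s sidings:
-- the headshunt list W₀ (from engine to points) and the siding lists
-- W₁ … W_s (each from points to buffer stop), sidings indexed by Fin s.
Config : ℕ → ℕ → Set
Config w s = List (Fin w) × Vec (List (Fin w)) s

headshunt : ∀ {w s} → Config w s → List (Fin w)
headshunt = proj₁

siding : ∀ {w s} → Config w s → Fin s → List (Fin w)
siding c i = lookup (proj₂ c) i

Valid : ∀ {w s} → (h : ℕ) → Vec ℕ s → Config w s → Set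
Valid {w} {s} h m c =
  ((headshunt c ++ concat (toList (proj₂ c))) ↭ allFin w)
  × (length (headshunt c) ≤ h)
  × (∀ (i : Fin s) → length (siding c i) ≤ lookup m i)

Move : ∀ {w s} → Config w s → Config w s → Set
Move {w} {s} c c' =
  (c ≢ c') ×
  Σ (Fin s) λ r →
    (∀ (i : Fin s) → i ≢ r → siding c i ≡ siding c' i)
    × (headshunt c ++ siding c r ≡ headshunt c' ++ siding c' r)

data Reach {w s : ℕ} (h : ℕ) (m : Vec ℕ s) : Config w s → Config w s → Set where
  here : ∀ {c} → Reach h m c c
  step : ∀ {c c' d} → Valid h m c' → Move c c' → Reach h m c' d → Reach h m c d

permuteConfig : ∀ {w s} → Permutation′ w → Config w s → Config w s
permuteConfig σ (hs , sd) = (L.map (σ ⟨$⟩ʳ_) hs , V.map (L.map (σ ⟨$⟩ʳ_)) sd)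

AlwaysSolvable : ∀ {w s} → (h : ℕ) → Vec ℕ s → (S F : Config w s → Set) → Set
AlwaysSolvable h m S F =
  ∀ p → Valid h m p → S p →
    ∃[ q ] (Valid h m q × F q × Reach h m p q)

Natural : ∀ {w s} → (h : ℕ) → Vec ℕ s → (S F : Config w s → Set) → Set
Natural {w} {s} h m S F =
  (∀ (σ : Permutation′ w) p → Valid h m p → S p → S (permuteConfig σ p))
  × (Σ (Fin s) λ z → Σ (Fin w) λ ω →
       ∀ q → Valid h m q → F q → last (siding q z) ≡ just ω)

maxTerm : ∀ {s} → ℕ → Vec ℕ s → ℕ
maxTerm h m = foldr′ _⊔_ (h ∸ 1) m

Star : ∀ {s} → ℕ → ℕ → Vec ℕ s → Set
Star w h m = (w + maxTerm h m) ≤ (h ∸ 1 + sum m)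

SolvableCase : (w s h : ℕ) → Vec ℕ s → Set
SolvableCase w s h m =
  (w > 1 × s > 1 × h > 1 × Star w h m)
  ⊎ (w > 1 × s > 2 × h ≡ 1 × Star w h m)
  ⊎ (w ≡ 1)

{-# OPTIONS --safe #-}
module Submission where

open import Defs
open import Data.Fin using (Fin; zero; suc)
import Data.Fin as F
open import Data.Fin.Permutation using (Permutation′; _⟨$⟩ʳ_; _⟨$⟩ˡ_; inverseʳ; inverseˡ; transpose)
import Data.Fin.Properties as FP
open import Data.List using (List; []; _∷_; [_]; _++_; _∷ʳ_; concat; length; take; drop; allFin; head; last)
import Data.List as L
open import Data.List.Membership.Propositional using (_∈_)
open import Data.List.Membership.Propositional.Properties using (∈-∃++; ∈-++⁻; ∈-allFin; ∈-map⁺)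
open import Data.List.Membership.Propositional.Properties.WithK using (unique∧set⇒bag)
open import Data.List.Properties
  using (length-++; length-map; length-reverse; length-tabulate; ++-assoc; ++-conicalˡ; ++-conicalʳ;
         ∷-injective; ∷-injectiveˡ; ∷-injectiveʳ; head-map; last-map; map-++; reverse-++; reverse-involutive;
         reverse-map; unfold-reverse)
open import Data.List.Relation.Binary.BagAndSetEquality using (∼bag⇒↭)
open import Data.List.Relation.Binary.Permutation.Propositional
  using (_↭_; refl; prep; swap; trans; ↭-sym; ↭-reflexive; ↭⇒↭ₛ)
open import Data.List.Relation.Binary.Permutation.Propositional.Properties
  using (↭-length; ↭-empty-inv; ↭-singleton-inv; ↭-reverse; drop-∷; map⁺; shift; shifts; ++⁺; ++⁺ˡ; ++⁺ʳ)
import Data.List.Relation.Binary.Permutation.Setoid.Properties as PermS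
open import Data.List.Relation.Unary.All using (_∷_)
open import Data.List.Relation.Unary.AllPairs using (_∷_)
open import Data.List.Relation.Unary.Any using (here; there)
import Data.List.Relation.Unary.Unique.Propositional.Properties as Unique
open import Data.Maybe using (Maybe; just)
import Data.Maybe as M
open import Data.Maybe.Properties using (just-injective)
open import Data.Nat
  using (ℕ; zero; suc; _+_; _∸_; _⊔_; _≤_; _<_; _≤?_; _<?_; _≟_; z≤n; s≤s; s≤s⁻¹)
open import Data.Nat.Properties
open import Data.Product using (_×_; _,_; ∃; ∃₂; ∃-syntax; proj₁; proj₂)
open import Data.Sum using (_⊎_; inj₁; inj₂)
open import Data.Vec using (Vec; []; _∷_; lookup; toList; tabulate; sum; foldr′; replicate; _[_]≔_)
import Data.Vec as V
open import Data.Vec.Functional using (updateAt)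
open import Data.Vec.Functional.Properties using (updateAt-updates; updateAt-minimal)
open import Data.Vec.Properties
  using (lookup-map; []≔-commutes; []≔-lookup; []≔-idempotent; lookup∘update; lookup∘update′;
         tabulate∘lookup; tabulate-cong)
open import Data.Vec.Relation.Unary.All using (All; []; _∷_)
open import Function using (_∘_; const)
open import Function.Bundles using (_⇔_; mk⇔)
open import Relation.Binary.Construct.Closure.ReflexiveTransitive
  using (ε; _◅_; _◅◅_) renaming (Star to Path; reverse to reverse-path)
open import Relation.Binary.PropositionalEquality
  using (_≡_; _≢_; refl; sym; cong; cong₂; subst; subst₂; ≢-sym; setoid; module ≡-Reasoning)
  renaming (trans to ≡-trans)
open import Relation.Nullary using (¬_; yes; no; contradiction)

-- If the last place of the headshunt is kept free for shunting, the rest of it acts as one more siding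
-- ("stack 0", of capacity h - 1), and a wagon can be taken from the front of any stack to any other stack
-- that is not full.  In these terms (∗) says that any stack can be emptied into the others.  So, to
-- interchange two neighbours in a stack, everything above them can be moved away; when both reach the top
-- there are two free places outside the stack, which a third stack allows to spread over two stacks, and
-- the pair is interchanged through these.  Such interchanges, together with those of the fronts of two
-- stacks, generate all rearrangements, so the graph is connected; a single wagon can always be pulled
-- into the headshunt.
-- In the remaining cases some wagon (the one at the engine, or at an end of a line of track) is an
-- invariant of the moves, and permuting the wagons gives it a value that is incompatible with ω being
-- the last wagon of siding z.

-- Sums over finite index sets and the pigeonhole principle.

total : ∀ {n} → (Fin n → ℕ) → ℕ
total f = sum (tabulate f)

total-lookup : ∀ {n} (v : Vec ℕ n) → total (lookup v) ≡ sum v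
total-lookup v = cong sum (tabulate∘lookup v)

total-update : ∀ {n} (f : Fin n → ℕ) j v → total (updateAt f j (const v)) + f j ≡ total f + v
total-update f zero v = begin
  (v + t) + f zero   ≡⟨ +-comm (v + t) (f zero) ⟩
  f zero + (v + t)   ≡⟨ cong (f zero +_) (+-comm v t) ⟩
  f zero + (t + v)   ≡⟨ sym (+-assoc (f zero) t v) ⟩
  (f zero + t) + v   ∎
  where open ≡-Reasoning
        t = total (f ∘ suc)
total-update f (suc j) v = begin
  (f zero + t') + f (suc j)   ≡⟨ +-assoc (f zero) t' _ ⟩
  f zero + (t' + f (suc j))   ≡⟨ cong (f zero +_) (total-update (f ∘ suc) j v) ⟩
  f zero + (t + v)            ≡⟨ sym (+-assoc (f zero) t v) ⟩
  (f zero + t) + v            ∎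
  where open ≡-Reasoning
        t = total (f ∘ suc)
        t' = total (updateAt (f ∘ suc) j (const v))

total-<⇒∃< : ∀ {n} (f g : Fin n → ℕ) → total f < total g → ∃ λ i → f i < g i
total-<⇒∃< {suc n} f g lt with f zero <? g zero
... | yes p = zero , p
... | no ¬p with total-<⇒∃< (f ∘ suc) (g ∘ suc) (+-cancelˡ-< (f zero) _ _
                   (<-≤-trans lt (+-monoˡ-≤ _ (≮⇒≥ ¬p))))
...   | i , q = suc i , q

-- An excess of `f` at `j` has to be compensated: once `j` is split off, the remaining totals
-- compare strictly and `total-<⇒∃<` applies.
total-≤⇒∃< : ∀ {n} (f g : Fin n → ℕ) {j} → total f ≤ total g → g j < f j → ∃ λ i → f i < g i
total-≤⇒∃< {suc n} f g {j} le gt with f zero <? g zero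
... | yes p = zero , p
total-≤⇒∃< {suc n} f g {zero} le gt | no ¬p
  with total-<⇒∃< (f ∘ suc) (g ∘ suc) (+-cancelˡ-< (f zero) _ _
         (≤-<-trans le (+-monoˡ-< _ gt)))
... | i , q = suc i , q
total-≤⇒∃< {suc n} f g {suc j} le gt | no ¬p
  with total-≤⇒∃< (f ∘ suc) (g ∘ suc) (+-cancelˡ-≤ (f zero) _ _
         (≤-trans le (+-monoˡ-≤ _ (≮⇒≥ ¬p)))) gt
... | i , q = suc i , q

total-mono-< : ∀ {n} (f g : Fin n → ℕ) {j} → (∀ i → f i ≤ g i) → f j < g j → total f < total g
total-mono-< f g le lt with total f <? total g
... | yes p = p
... | no ¬p with total-≤⇒∃< g f (≮⇒≥ ¬p) lt
...   | i , q = contradiction (le i) (<⇒≱ q)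

total-mono-≤ : ∀ {n} (f g : Fin n → ℕ) → (∀ i → f i ≤ g i) → total f ≤ total g
total-mono-≤ f g le with total f ≤? total g
... | yes p = p
... | no ¬p with total-<⇒∃< g f (≰⇒> ¬p)
...   | i , q = contradiction (le i) (<⇒≱ q)

-- Raising `f` at `j` to one more than the capacity there still keeps the total within `total c`.
-- Hence some entry is below its capacity, and it cannot be `j`, which is above.
room-outside : ∀ {n} (f c : Fin n → ℕ) j → total f + suc (c j) ≤ f j + total c → ∃ λ k → k ≢ j × f k < c k
room-outside f c j le
  with total-≤⇒∃< f′ c {j}
         (+-cancelʳ-≤ (f j) _ _ (≤-trans (≤-reflexive (total-update f j (suc (c j))))
           (≤-trans le (≤-reflexive (+-comm (f j) _)))))
         (≤-reflexive (sym (updateAt-updates j f)))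
  where f′ = updateAt f j (const (suc (c j)))
... | k , lt with k F.≟ j
...   | yes refl = contradiction (subst (_< c k) (updateAt-updates k f) lt) (<⇒≱ (n<1+n (c k)) ∘ <⇒≤)
...   | no k≢j = k , k≢j , subst (_< c k) (updateAt-minimal k j f k≢j) lt

-- Stacks as a vector of lists, and words cut into stacks.

lookup-ext : ∀ {a} {A : Set a} {n} {xs ys : Vec A n} → (∀ i → lookup xs i ≡ lookup ys i) → xs ≡ ys
lookup-ext {xs = xs} {ys} eq =
  ≡-trans (sym (tabulate∘lookup xs)) (≡-trans (tabulate-cong eq) (tabulate∘lookup ys))

content : ∀ {A : Set} {n} → Vec (List A) n → List A
content C = concat (toList C)

content-length : ∀ {A : Set} {n} (C : Vec (List A) n) → length (content C) ≡ total (length ∘ lookup C)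
content-length [] = refl
content-length (c ∷ C) = ≡-trans (length-++ c) (cong (length c +_) (content-length C))

content-extract : ∀ {A : Set} {n} (C : Vec (List A) n) i {x a} → lookup C i ↭ x ∷ a →
  content C ↭ x ∷ content (C [ i ]≔ a)
content-extract (c ∷ C) zero p = ++⁺ʳ (content C) p
content-extract (c ∷ C) (suc i) p =
  trans (++⁺ˡ c (content-extract C i p)) (shift _ c _)

-- Once the stack sizes are fixed, an arrangement is determined by the single word `content C`, from
-- which `fill` recovers it. Rearranging stacks thus becomes permuting one word.
fill : ∀ {A : Set} {n} → Vec ℕ n → List A → Vec (List A) n
fill [] u = []
fill (k ∷ ks) u = take k u ∷ fill ks (drop k u)

-- Chosen so that `fill (suc k ∷ ks) (z ∷ u)` is by definition `push z (fill (k ∷ ks) u)`, which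
-- drives the inductions on `fill`.
push : ∀ {A : Set} {n} → A → Vec (List A) (suc n) → Vec (List A) (suc n)
push x (a ∷ C) = (x ∷ a) ∷ C

fill-content : ∀ {A : Set} {n} (C : Vec (List A) n) → fill (V.map length C) (content C) ≡ C
fill-content [] = refl
fill-content ([] ∷ C) = cong ([] ∷_) (fill-content C)
fill-content ((x ∷ a) ∷ C) = cong (push x) (fill-content (a ∷ C))

-- The effect on the stacks of interchanging two neighbours in the word: either one stack contains
-- both, or a cut separates them.
data Swapped {A : Set} {n} (C E : Vec (List A) n) : Set where
  within : ∀ j p {x y r} → lookup C j ≡ p ++ x ∷ y ∷ r → E ≡ C [ j ]≔ (p ++ y ∷ x ∷ r) → Swapped C E
  across : ∀ {i j} → i ≢ j → ∀ p q {x y r t} → lookup C i ≡ p ++ x ∷ r → lookup C j ≡ q ++ y ∷ t →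
    E ≡ (C [ i ]≔ (p ++ y ∷ r)) [ j ]≔ (q ++ x ∷ t) → Swapped C E

swapped-∷ : ∀ {A : Set} {n} c {C E : Vec (List A) n} → Swapped C E → Swapped (c ∷ C) (c ∷ E)
swapped-∷ c (within j p e eq) = within (suc j) p e (cong (c ∷_) eq)
swapped-∷ c (across i≢j p q e e′ eq) = across (i≢j ∘ FP.suc-injective) p q e e′ (cong (c ∷_) eq)

swapped-push : ∀ {A : Set} {n} z {C E : Vec (List A) (suc n)} → Swapped C E → Swapped (push z C) (push z E)
swapped-push z {c ∷ C} (within zero p e eq) = within zero (z ∷ p) (cong (z ∷_) e) (cong (push z) eq)
swapped-push z {c ∷ C} (within (suc j) p e eq) = within (suc j) p e (cong (push z) eq)
swapped-push z {c ∷ C} (across {zero} {zero} i≢j p q e e′ eq) = contradiction refl i≢j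
swapped-push z {c ∷ C} (across {zero} {suc j} i≢j p q e e′ eq) =
  across i≢j (z ∷ p) q (cong (z ∷_) e) e′ (cong (push z) eq)
swapped-push z {c ∷ C} (across {suc i} {zero} i≢j p q e e′ eq) =
  across i≢j p (z ∷ q) e (cong (z ∷_) e′) (cong (push z) eq)
swapped-push z {c ∷ C} (across {suc i} {suc j} i≢j p q e e′ eq) = across i≢j p q e e′ (cong (push z) eq)

-- The first letter lands on the first stack of positive size. Stacks of size 0 may come before it,
-- so the index `j` has to be searched for.
fill-top : ∀ {A : Set} {n} (ks : Vec ℕ n) (x y : A) r → 1 ≤ sum ks →
  ∃₂ λ j q → lookup (fill ks (y ∷ r)) j ≡ y ∷ q × fill ks (x ∷ r) ≡ fill ks (y ∷ r) [ j ]≔ (x ∷ q)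
fill-top (zero ∷ ks) x y r le with fill-top ks x y r le
... | j , q , e , eq = suc j , q , e , cong ([] ∷_) eq
fill-top (suc k ∷ ks) x y r le = zero , take k r , refl , refl

-- The prefix `p` is peeled off letter by letter until the pair comes first; then the size of the
-- current stack decides between `within` and `across`. The length bound ensures that the cut does
-- not drop either letter.
fill-swap : ∀ {A : Set} {n} (ks : Vec ℕ n) p {x y : A} {r} → length (p ++ x ∷ y ∷ r) ≤ sum ks →
  Swapped (fill ks (p ++ x ∷ y ∷ r)) (fill ks (p ++ y ∷ x ∷ r))
fill-swap [] [] ()
fill-swap [] (z ∷ p) ()
fill-swap (zero ∷ ks) p le = swapped-∷ [] (fill-swap ks p le)
fill-swap (suc k ∷ ks) (z ∷ p) (s≤s le) = swapped-push z (fill-swap (k ∷ ks) p le)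
fill-swap (suc zero ∷ ks) [] {x} {y} {r} (s≤s le) with fill-top ks x y r (≤-trans (s≤s z≤n) le)
... | j , q , e , eq = across {i = zero} {j = suc j} (λ ()) [] [] refl e (cong ([ y ] ∷_) eq)
fill-swap (suc (suc k) ∷ ks) [] le = within zero [] refl refl

-- Stacks with bounded capacities: interchanging wagons by hops.

module Stacks {A : Set} {n : ℕ} (c : Vec ℕ n) (w : ℕ)
  (third : ∀ (i j : Fin n) → ∃ λ k → k ≢ i × k ≢ j × 1 ≤ lookup c k)
  (roomy : ∀ (j : Fin n) → w + lookup c j ≤ sum c) where

  record Fits (C : Vec (List A) n) : Set where
    constructor fitting
    field fit : ∀ i → length (lookup C i) ≤ lookup c i

  open Fits public

  -- Described by equations between entries rather than as an update of `C`, so that the reverse hop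
  -- only exchanges `source` and `target`.
  record Hop (C D : Vec (List A) n) : Set where
    constructor hopping
    field
      {from to} : Fin n
      {wagon}   : A
      distinct  : from ≢ to
      source    : lookup C from ≡ wagon ∷ lookup D from
      target    : lookup D to ≡ wagon ∷ lookup C to
      elsewhere : ∀ k → k ≢ from → k ≢ to → lookup C k ≡ lookup D k
      fits      : Fits C
      fits′     : Fits D

  hop-sym : ∀ {C D} → Hop C D → Hop D C
  hop-sym (hopping d s t e f f′) = hopping (≢-sym d) t s (λ k p q → sym (e k q p)) f′ f

  infix 4 _~_
  _~_ : Vec (List A) n → Vec (List A) n → Set
  _~_ = Path Hop

  ~-sym : ∀ {C D} → C ~ D → D ~ C
  ~-sym = reverse-path hop-sym

  ~-reflexive : ∀ {C D} → C ≡ D → C ~ D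
  ~-reflexive refl = ε

  -- Taking the moved wagon off its stack before the hop, or off its stack after it, leaves the same
  -- vector of stacks.
  hop-content : ∀ {C D} → Hop C D → content C ↭ content D
  hop-content {C} {D} (hopping {i} {j} {x} i≢j s t e _ _) =
    trans (content-extract C i (↭-reflexive s))
      (trans (↭-reflexive (cong (λ E → x ∷ content E) {C [ i ]≔ lookup D i} {D [ j ]≔ lookup C j} (lookup-ext same)))
        (↭-sym (content-extract D j (↭-reflexive t))))
    where
    same : ∀ k → lookup (C [ i ]≔ lookup D i) k ≡ lookup (D [ j ]≔ lookup C j) k
    same k with k F.≟ i | k F.≟ j
    ... | yes refl | _ = ≡-trans (lookup∘update i C _) (sym (lookup∘update′ i≢j D _))
    ... | no k≢i | yes refl = ≡-trans (lookup∘update′ k≢i C _) (sym (lookup∘update j D _))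
    ... | no k≢i | no k≢j =
      ≡-trans (lookup∘update′ k≢i C _) (≡-trans (e k k≢i k≢j) (sym (lookup∘update′ k≢j D _)))

  ~-content : ∀ {C D} → C ~ D → content C ↭ content D
  ~-content ε = refl
  ~-content (s ◅ r) = trans (hop-content s) (~-content r)

  record Good (C : Vec (List A) n) : Set where
    constructor good
    field
      good-fits : Fits C
      good-size : length (content C) ≡ w

  open Good public

  good-~ : ∀ {C D} → C ~ D → Good C → Good D
  good-~ ε g = g
  good-~ (s ◅ r) (good _ l) = good-~ r (good (Hop.fits′ s) (≡-trans (sym (↭-length (hop-content s))) l))

  fits-update : ∀ {C} → Fits C → ∀ i {a} → length a ≤ lookup c i → Fits (C [ i ]≔ a)
  fits-update {C} f i {a} le = fitting go
    where
    go : ∀ k → length (lookup (C [ i ]≔ a) k) ≤ lookup c k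
    go k with k F.≟ i
    ... | yes refl = subst (λ l → length l ≤ lookup c i) (sym (lookup∘update i C a)) le
    ... | no k≢i = subst (λ l → length l ≤ lookup c k) (sym (lookup∘update′ k≢i C a)) (fit f k)

  lookup-update₂ : ∀ {i j} → i ≢ j → ∀ (C : Vec (List A) n) a b → lookup ((C [ i ]≔ a) [ j ]≔ b) i ≡ a
  lookup-update₂ {i} {j} i≢j C a b = ≡-trans (lookup∘update′ i≢j (C [ i ]≔ a) b) (lookup∘update i C a)

  hop₂ : ∀ {C} → Fits C → ∀ i j {x a b} → i ≢ j → length a < lookup c i → length b < lookup c j →
    (C [ i ]≔ (x ∷ a)) [ j ]≔ b ~ (C [ i ]≔ a) [ j ]≔ (x ∷ b)
  hop₂ {C} f i j {x} {a} {b} i≢j la lb = hopping i≢j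
    (≡-trans (lookup-update₂ i≢j C (x ∷ a) b) (cong (x ∷_) (sym (lookup-update₂ i≢j C a (x ∷ b)))))
    (≡-trans (lookup∘update j (C [ i ]≔ a) (x ∷ b)) (cong (x ∷_) (sym (lookup∘update j (C [ i ]≔ (x ∷ a)) b))))
    (λ k k≢i k≢j → ≡-trans (untouched k k≢i k≢j (x ∷ a) b) (sym (untouched k k≢i k≢j a (x ∷ b))))
    (fits-update (fits-update f i la) j (<⇒≤ lb))
    (fits-update (fits-update f i (<⇒≤ la)) j lb) ◅ ε
    where
    untouched : ∀ k → k ≢ i → k ≢ j → ∀ u v → lookup ((C [ i ]≔ u) [ j ]≔ v) k ≡ lookup C k
    untouched k k≢i k≢j u v = ≡-trans (lookup∘update′ k≢j (C [ i ]≔ u) v) (lookup∘update′ k≢i C u)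

  update₂-self : ∀ (C : Vec (List A) n) i j {a b} → lookup C i ≡ a → lookup C j ≡ b → C ≡ (C [ i ]≔ a) [ j ]≔ b
  update₂-self C i j refl refl =
    sym (≡-trans (cong (_[ j ]≔ lookup C j) ([]≔-lookup C i)) ([]≔-lookup C j))

  -- Since `j` is not empty, fewer than `w` wagons stand elsewhere, while by `roomy` the other
  -- stacks can hold `w`.
  room : ∀ {C} → Good C → ∀ j {x xs} → lookup C j ≡ x ∷ xs → ∃ λ k → k ≢ j × length (lookup C k) < lookup c k
  room {C} (good _ l) j {x} {xs} eq = room-outside _ (lookup c) j (begin
    total (length ∘ lookup C) + suc (lookup c j) ≡⟨ cong (_+ suc (lookup c j)) (≡-trans (sym (content-length C)) l) ⟩
    w + suc (lookup c j)                         ≡⟨ +-suc w _ ⟩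
    suc (w + lookup c j)                         ≤⟨ s≤s (roomy j) ⟩
    suc (sum c)                                  ≡⟨ cong suc (sym (total-lookup c)) ⟩
    suc (total (lookup c))                       ≤⟨ s≤s (m≤n+m _ (length xs)) ⟩
    length (x ∷ xs) + total (lookup c)           ≡⟨ cong (λ u → length u + total (lookup c)) (sym eq) ⟩
    length (lookup C j) + total (lookup c)       ∎)
    where open ≤-Reasoning

  -- A fictitious wagon is put on the first place found and the count is repeated. The second place
  -- is then either on a new stack or once more on `i`.
  room-twice : ∀ {C} → Good C → ∀ j {x y xs} → lookup C j ≡ x ∷ y ∷ xs →
    (∃₂ λ i k → i ≢ j × k ≢ j × i ≢ k × length (lookup C i) < lookup c i × length (lookup C k) < lookup c k)
    ⊎ (∃ λ i → i ≢ j × suc (length (lookup C i)) < lookup c i)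
  room-twice {C} g@(good _ l) j {x} {y} {xs} eq with room g j eq
  ... | i , i≢j , lt with room-outside f (lookup c) j (begin
    total f + suc (lookup c j)                   ≡⟨ cong (_+ suc (lookup c j)) total-f ⟩
    suc w + suc (lookup c j)                     ≡⟨ +-suc (suc w) _ ⟩
    suc (suc w + lookup c j)                     ≤⟨ s≤s (s≤s (roomy j)) ⟩
    2 + sum c                                    ≡⟨ cong (2 +_) (sym (total-lookup c)) ⟩
    2 + total (lookup c)                         ≤⟨ s≤s (s≤s (m≤n+m _ (length xs))) ⟩
    length (x ∷ y ∷ xs) + total (lookup c)       ≡⟨ cong (λ u → length u + total (lookup c)) (sym eq) ⟩
    length (lookup C j) + total (lookup c)       ≡⟨ cong (_+ total (lookup c)) (sym (updateAt-minimal j i _ (≢-sym i≢j))) ⟩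
    f j + total (lookup c)                       ∎)
    where
    open ≤-Reasoning
    len = length ∘ lookup C
    f = updateAt len i (const (suc (len i)))
    total-f : total f ≡ suc w
    total-f = +-cancelʳ-≡ (len i) _ _ (≡-trans (total-update len i (suc (len i)))
      (≡-trans (+-suc (total len) (len i)) (cong (λ u → suc (u + len i)) (≡-trans (sym (content-length C)) l))))
  ...   | k , k≢j , lt′ with k F.≟ i
  ...     | yes refl = inj₂ (k , k≢j , subst (_< lookup c k) (updateAt-updates k _) lt′)
  ...     | no k≢i = inj₁ (i , k , i≢j , k≢j , ≢-sym k≢i , lt , subst (_< lookup c k) (updateAt-minimal k i _ k≢i) lt′)

  update-keep : ∀ (C : Vec (List A) n) {i j} a {b} → i ≢ j → lookup C i ≡ b → (C [ j ]≔ a) [ i ]≔ b ≡ C [ j ]≔ a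
  update-keep C {i} {j} a i≢j refl =
    ≡-trans (cong ((C [ j ]≔ a) [ i ]≔_) (sym (lookup∘update′ i≢j C a))) ([]≔-lookup (C [ j ]≔ a) i)

  -- A frame for manoeuvres on three stacks, all other stacks being those of `C`. The laws
  -- `exchange₁₂` and `exchange₂₃` reduce the hops between any two of the three to `hop₂₃`.
  module Three (C : Vec (List A) n) (f : Fits C) where

    infix 4.5 _↦_,_↦_,_↦_
    _↦_,_↦_,_↦_ : Fin n → List A → Fin n → List A → Fin n → List A → Vec (List A) n
    i ↦ a , j ↦ b , k ↦ d = ((C [ i ]≔ a) [ j ]≔ b) [ k ]≔ d

    self : ∀ i j k {a b d} → lookup C i ≡ a → lookup C j ≡ b → lookup C k ≡ d → C ≡ i ↦ a , j ↦ b , k ↦ d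
    self i j k p q refl =
      ≡-trans (sym ([]≔-lookup C k)) (cong (_[ k ]≔ lookup C k) (update₂-self C i j p q))

    restore : ∀ {j i k} a {b d} → i ≢ j → k ≢ j → lookup C i ≡ b → lookup C k ≡ d →
      j ↦ a , i ↦ b , k ↦ d ≡ C [ j ]≔ a
    restore {j} {i} {k} a {b} {d} i≢j k≢j p q =
      ≡-trans (cong (_[ k ]≔ d) (update-keep C a i≢j p)) (update-keep C a k≢j q)

    restore₂ : ∀ {i j k} a b {d} → k ≢ i → k ≢ j → lookup C k ≡ d →
      i ↦ a , j ↦ b , k ↦ d ≡ (C [ i ]≔ a) [ j ]≔ b
    restore₂ {i} a b k≢i k≢j p = update-keep (C [ i ]≔ a) b k≢j (≡-trans (lookup∘update′ k≢i C a) p)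

    lookup₁ : ∀ {i j k a b d} → i ≢ j → i ≢ k → lookup (i ↦ a , j ↦ b , k ↦ d) i ≡ a
    lookup₁ {i} {j} {k} {a} {b} {d} i≢j i≢k =
      ≡-trans (lookup∘update′ i≢k ((C [ i ]≔ a) [ j ]≔ b) d) (lookup-update₂ i≢j C a b)

    reset₁ : ∀ {i j k a a′ b d} → i ≢ j → i ≢ k → (i ↦ a , j ↦ b , k ↦ d) [ i ]≔ a′ ≡ i ↦ a′ , j ↦ b , k ↦ d
    reset₁ {i} {j} {k} {a} {a′} {b} {d} i≢j i≢k =
      ≡-trans ([]≔-commutes ((C [ i ]≔ a) [ j ]≔ b) k i (≢-sym i≢k))
        (cong (_[ k ]≔ d) (≡-trans ([]≔-commutes (C [ i ]≔ a) j i (≢-sym i≢j))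
          (cong (_[ j ]≔ b) ([]≔-idempotent C i))))

    hop₂₃ : ∀ {i j k a b d x} → j ≢ k →
      length a ≤ lookup c i → length b < lookup c j → length d < lookup c k →
      i ↦ a , j ↦ x ∷ b , k ↦ d ~ i ↦ a , j ↦ b , k ↦ x ∷ d
    hop₂₃ {i} {j} {k} j≢k la lb ld = hop₂ (fits-update f i la) j k j≢k lb ld

    exchange₁₂ : ∀ {i j k a b d} → i ≢ j → i ↦ a , j ↦ b , k ↦ d ≡ j ↦ b , i ↦ a , k ↦ d
    exchange₁₂ {k = k} {d = d} i≢j = cong (_[ k ]≔ d) ([]≔-commutes C _ _ i≢j)

    exchange₂₃ : ∀ {i j k a b d} → j ≢ k → i ↦ a , j ↦ b , k ↦ d ≡ i ↦ a , k ↦ d , j ↦ b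
    exchange₂₃ {i} {a = a} j≢k = []≔-commutes (C [ i ]≔ a) _ _ j≢k

    hop₁₃ : ∀ {i j k a b d x} → i ≢ j → i ≢ k →
      length a < lookup c i → length b ≤ lookup c j → length d < lookup c k →
      i ↦ x ∷ a , j ↦ b , k ↦ d ~ i ↦ a , j ↦ b , k ↦ x ∷ d
    hop₁₃ i≢j i≢k la lb ld = subst₂ _~_ (sym (exchange₁₂ i≢j)) (sym (exchange₁₂ i≢j)) (hop₂₃ i≢k lb la ld)

    hop₁₂ : ∀ {i j k a b d x} → i ≢ j → i ≢ k → j ≢ k →
      length a < lookup c i → length b < lookup c j → length d ≤ lookup c k →
      i ↦ x ∷ a , j ↦ b , k ↦ d ~ i ↦ a , j ↦ x ∷ b , k ↦ d
    hop₁₂ i≢j i≢k j≢k la lb ld = subst₂ _~_ (sym (exchange₂₃ j≢k)) (sym (exchange₂₃ j≢k)) (hop₁₃ i≢k i≢j la ld lb)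

    -- `x` goes to `i` and `y` to `k`; then they return in the order in which they left, so `y` ends
    -- up on top.
    top-swap : ∀ {j i k x y r a d} → j ≢ i → j ≢ k → i ≢ k →
      2 + length r ≤ lookup c j → length a < lookup c i → length d < lookup c k →
      j ↦ x ∷ y ∷ r , i ↦ a , k ↦ d ~ j ↦ y ∷ x ∷ r , i ↦ a , k ↦ d
    top-swap j≢i j≢k i≢k lr la ld =
         hop₁₂ j≢i j≢k i≢k lr la (<⇒≤ ld)
      ◅◅ hop₁₃ j≢i j≢k (<⇒≤ lr) la ld
      ◅◅ ~-sym (hop₁₂ j≢i j≢k i≢k (<⇒≤ lr) la ld)
      ◅◅ ~-sym (hop₁₃ j≢i j≢k lr (<⇒≤ la) ld)

    -- `x` waits on `k` while `y` moves from `j` to `i`, and then takes the place left on `j`.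
    tops-swap-via : ∀ {i j k x y p q d} → i ≢ j → i ≢ k → j ≢ k →
      length p < lookup c i → length q < lookup c j → length d < lookup c k →
      i ↦ x ∷ p , j ↦ y ∷ q , k ↦ d ~ i ↦ y ∷ p , j ↦ x ∷ q , k ↦ d
    tops-swap-via i≢j i≢k j≢k lp lq ld =
         hop₁₃ i≢j i≢k lp lq ld
      ◅◅ ~-sym (hop₁₂ i≢j i≢k j≢k lp lq ld)
      ◅◅ ~-sym (hop₂₃ j≢k lp lq ld)

  fits-at : ∀ {C} → Fits C → ∀ i {a} → lookup C i ≡ a → length a ≤ lookup c i
  fits-at f i refl = fit f i

  adjacent-swap : ∀ {C} → Good C → ∀ j p {x y r} → lookup C j ≡ p ++ x ∷ y ∷ r → C ~ C [ j ]≔ (p ++ y ∷ x ∷ r)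
  adjacent-swap {C} g@(good f _) j [] {x} {y} {r} eq = cases (room-twice g j eq)
    where
    open Three C f
    in-frame : ∀ {i k b d} → i ≢ j → k ≢ j → lookup C i ≡ b → lookup C k ≡ d →
      j ↦ x ∷ y ∷ r , i ↦ b , k ↦ d ~ j ↦ y ∷ x ∷ r , i ↦ b , k ↦ d → C ~ C [ j ]≔ (y ∷ x ∷ r)
    in-frame {i} {k} i≢j k≢j p q path =
      subst₂ _~_ (sym (self j i k eq p q)) (restore (y ∷ x ∷ r) i≢j k≢j p q) path

    cases : _ → C ~ C [ j ]≔ (y ∷ x ∷ r)
    cases (inj₁ (i , k , i≢j , k≢j , i≢k , li , lk)) = in-frame i≢j k≢j refl refl
      (top-swap (≢-sym i≢j) (≢-sym k≢j) i≢k (fits-at f j eq) li lk)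
    -- Both places are on `i`. Wagons stacked there together would return in their old order, so a
    -- third stack is brought in.
    cases (inj₂ (i , i≢j , li)) with third i j
    ... | k , k≢i , k≢j , 1≤ck = go (lookup C k) refl
      where
      go : ∀ d → lookup C k ≡ d → C ~ C [ j ]≔ (y ∷ x ∷ r)
      go [] ek = in-frame i≢j k≢j refl ek
        (top-swap (≢-sym i≢j) (≢-sym k≢j) (≢-sym k≢i) (fits-at f j eq) (<⇒≤ li) 1≤ck)
      -- Moving the top of `k` onto `i` leaves a place on each of the two stacks; it goes back after
      -- the swap.
      go (z ∷ t) ek = in-frame i≢j k≢j refl ek
        (   ~-sym (hop₂₃ {b = lookup C i} {d = t} (≢-sym k≢i) (fits-at f j eq) (<⇒≤ li) (fits-at f k ek))
         ◅◅ top-swap {a = z ∷ lookup C i} {d = t} (≢-sym i≢j) (≢-sym k≢j) (≢-sym k≢i) (fits-at f j eq) li (fits-at f k ek)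
         ◅◅ hop₂₃ {b = lookup C i} {d = t} (≢-sym k≢i) (fits-at f j eq) (<⇒≤ li) (fits-at f k ek))
  adjacent-swap {C} g@(good f _) j (z ∷ p) {x} {y} {r} eq with room g j eq
  -- `z` is set aside on `i`. The result of the recursive call differs only at `j`, so `z` is still
  -- on top of `i` and can be taken back.
  ... | i , i≢j , li =
       subst (_~ D) (sym C≡) down
    ◅◅ adjacent-swap (good-~ down (subst Good C≡ g)) j p (lookup-update₂ j≢i C v (z ∷ b))
    ◅◅ subst₂ _~_ (sym redo) (update-keep C (z ∷ v′) i≢j refl)
         (~-sym (hop₂ f j i j≢i lv li))
    where
    j≢i = ≢-sym i≢j
    v = p ++ x ∷ y ∷ r
    v′ = p ++ y ∷ x ∷ r
    b = lookup C i
    D = (C [ j ]≔ v) [ i ]≔ (z ∷ b)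
    C≡ : C ≡ (C [ j ]≔ (z ∷ v)) [ i ]≔ b
    C≡ = update₂-self C j i eq refl
    down : (C [ j ]≔ (z ∷ v)) [ i ]≔ b ~ D
    down = hop₂ f j i j≢i (fits-at f j eq) li
    lv : length v′ < lookup c j
    lv = ≤-trans (≤-reflexive (cong suc (≡-trans (length-++ p) (sym (length-++ p))))) (fits-at f j eq)
    redo : D [ j ]≔ v′ ≡ (C [ j ]≔ v′) [ i ]≔ (z ∷ b)
    redo = ≡-trans ([]≔-commutes (C [ j ]≔ v) i j i≢j) (cong (_[ i ]≔ (z ∷ b)) ([]≔-idempotent C j))

  tops-swap-roomy : ∀ {C} → Good C → ∀ {i j k} → i ≢ j → k ≢ i → k ≢ j → ∀ {x y p q} →
    lookup C i ≡ x ∷ p → lookup C j ≡ y ∷ q → length (lookup C k) < lookup c k →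
    C ~ (C [ i ]≔ (y ∷ p)) [ j ]≔ (x ∷ q)
  tops-swap-roomy {C} (good f _) {i} {j} {k} i≢j k≢i k≢j {x} {y} {p} {q} ei ej lk =
    subst₂ _~_ (sym (self i j k ei ej refl)) (restore₂ (y ∷ p) (x ∷ q) k≢i k≢j refl)
      (tops-swap-via i≢j (≢-sym k≢i) (≢-sym k≢j) (fits-at f i ei) (fits-at f j ej) lk)
    where open Three C f

  -- When the spare place is on i itself and the third stack k is full, the top of k is parked on i,
  -- which frees a place on k but leaves the wagon to be exchanged in second position.
  tops-swap-parked : ∀ {C} → Good C → ∀ {i j} → i ≢ j → ∀ {x y p q} →
    lookup C i ≡ x ∷ p → lookup C j ≡ y ∷ q → length (lookup C i) < lookup c i →
    C ~ (C [ i ]≔ (y ∷ p)) [ j ]≔ (x ∷ q)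
  tops-swap-parked {C} g@(good f _) {i} {j} i≢j {x} {y} {p} {q} ei ej li with third i j
  ... | k , k≢i , k≢j , 1≤ck = go (lookup C k) refl
    where
    open Three C f
    li′ : suc (length p) < lookup c i
    li′ = subst (λ u → length u < lookup c i) ei li
    lj = fits-at f j ej
    go : ∀ d → lookup C k ≡ d → C ~ (C [ i ]≔ (y ∷ p)) [ j ]≔ (x ∷ q)
    go [] ek = tops-swap-roomy g i≢j k≢i k≢j ei ej (subst (λ u → length u < lookup c k) (sym ek) 1≤ck)
    go (z ∷ t) ek =
      subst₂ _~_ (sym C≡) (restore₂ (y ∷ p) (x ∷ q) k≢i k≢j ek) (s₁ ◅◅ s₂ ◅◅ s₃ ◅◅ s₄ ◅◅ s₅)
      where
      i≢k = ≢-sym k≢i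
      lk = fits-at f k ek
      S : List A → List A → List A → Vec (List A) n
      S a b d = i ↦ a , j ↦ b , k ↦ d
      C≡ : C ≡ S (x ∷ p) (y ∷ q) (z ∷ t)
      C≡ = self i j k ei ej ek
      i-swap : ∀ {u v r b d} → Good (S (u ∷ v ∷ r) b d) → S (u ∷ v ∷ r) b d ~ S (v ∷ u ∷ r) b d
      i-swap {u} {v} {r} {b} {d} g′ = subst (S (u ∷ v ∷ r) b d ~_) (reset₁ i≢j i≢k)
        (adjacent-swap g′ i [] (lookup₁ i≢j i≢k))
      s₁ : S (x ∷ p) (y ∷ q) (z ∷ t) ~ S (z ∷ x ∷ p) (y ∷ q) t
      s₁ = ~-sym (hop₁₃ i≢j i≢k li′ lj lk)
      g₁ = good-~ s₁ (subst Good C≡ g)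
      s₂ : S (z ∷ x ∷ p) (y ∷ q) t ~ S (x ∷ z ∷ p) (y ∷ q) t
      s₂ = i-swap g₁
      s₃ : S (x ∷ z ∷ p) (y ∷ q) t ~ S (y ∷ z ∷ p) (x ∷ q) t
      s₃ = tops-swap-via i≢j i≢k (≢-sym k≢j) li′ lj lk
      s₄ : S (y ∷ z ∷ p) (x ∷ q) t ~ S (z ∷ y ∷ p) (x ∷ q) t
      s₄ = i-swap (good-~ s₃ (good-~ s₂ g₁))
      s₅ : S (z ∷ y ∷ p) (x ∷ q) t ~ S (y ∷ p) (x ∷ q) (z ∷ t)
      s₅ = hop₁₃ i≢j i≢k li′ lj lk

  -- The place found outside `j` is either on a third stack, which then serves as the temporary
  -- place, or on `i` itself.
  tops-swap : ∀ {C} → Good C → ∀ {i j} → i ≢ j → ∀ {x y p q} →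
    lookup C i ≡ x ∷ p → lookup C j ≡ y ∷ q → C ~ (C [ i ]≔ (y ∷ p)) [ j ]≔ (x ∷ q)
  tops-swap {C} g {i} {j} i≢j {x} {y} {p} {q} ei ej with room g j ej
  ... | k , k≢j , lk with k F.≟ i
  ...   | no k≢i = tops-swap-roomy g i≢j k≢i k≢j ei ej lk
  ...   | yes refl = tops-swap-parked g i≢j ei ej lk

  -- Induction on the derivation of `u ↭ v`. The prefix `pre` collects the wagons that `prep` and
  -- `swap` leave above the part still to be permuted.
  rearrange : ∀ {C} → Good C → ∀ j pre {u v} → u ↭ v → lookup C j ≡ pre ++ u → C ~ C [ j ]≔ (pre ++ v)
  rearrange {C} g j pre refl eq = ~-reflexive (sym (≡-trans (cong (C [ j ]≔_) (sym eq)) ([]≔-lookup C j)))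
  rearrange {C} g j pre (prep {xs} {ys} x u↭v) eq =
    subst (λ u → C ~ C [ j ]≔ u) (++-assoc pre [ x ] ys)
      (rearrange g j (pre ++ [ x ]) u↭v (≡-trans eq (sym (++-assoc pre [ x ] xs))))
  rearrange {C} g j pre (swap {xs} {ys} x y u↭v) eq =
    s ◅◅ subst (C [ j ]≔ v ~_) (≡-trans ([]≔-idempotent C j) (cong (C [ j ]≔_) (++-assoc pre (y ∷ [ x ]) ys)))
      (rearrange (good-~ s g) j (pre ++ y ∷ [ x ]) u↭v
        (≡-trans (lookup∘update j C v) (sym (++-assoc pre (y ∷ [ x ]) xs))))
    where
    v = pre ++ y ∷ x ∷ xs
    s : C ~ C [ j ]≔ v
    s = adjacent-swap g j pre eq
  rearrange {C} g j pre (trans {ys = u′} {zs = v} p q) eq =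
    s ◅◅ subst (C [ j ]≔ (pre ++ u′) ~_) ([]≔-idempotent C j)
      (rearrange (good-~ s g) j pre q (lookup∘update j C (pre ++ u′)))
    where
    s : C ~ C [ j ]≔ (pre ++ u′)
    s = rearrange g j pre p eq

  -- Each stack can be reordered at will, so `x` and `y` are brought to the tops, interchanged
  -- there, and the stacks put into the orders `a` and `b`.
  exchange : ∀ {C} → Good C → ∀ {i j} → i ≢ j → ∀ {x y p q a b} →
    lookup C i ↭ x ∷ p → a ↭ y ∷ p → lookup C j ↭ y ∷ q → b ↭ x ∷ q → C ~ (C [ i ]≔ a) [ j ]≔ b
  exchange {C} g {i} {j} i≢j {x} {y} {p} {q} {a} {b} ei ea ej eb =
    s₁ ◅◅ s₂ ◅◅ s₃ ◅◅ s₄ ◅◅ s₅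
    where
    S : List A → List A → Vec (List A) n
    S u v = (C [ i ]≔ u) [ j ]≔ v
    set-i : ∀ {u u′ v} → Good (S u v) → u ↭ u′ → S u v ~ S u′ v
    set-i {u} {u′} {v} gS pf = subst (S u v ~_)
      (≡-trans ([]≔-commutes (C [ i ]≔ u) j i (≢-sym i≢j)) (cong (_[ j ]≔ v) ([]≔-idempotent C i)))
      (rearrange gS i [] pf (lookup-update₂ i≢j C u v))
    set-j : ∀ {u v v′} → Good (S u v) → v ↭ v′ → S u v ~ S u v′
    set-j {u} {v} {v′} gS pf = subst (S u v ~_) ([]≔-idempotent (C [ i ]≔ u) j)
      (rearrange gS j [] pf (lookup∘update j (C [ i ]≔ u) v))
    s₀ : C ~ S (lookup C i) (lookup C j)
    s₀ = ~-reflexive (update₂-self C i j refl refl)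
    s₁ : C ~ S (x ∷ p) (lookup C j)
    s₁ = s₀ ◅◅ set-i (good-~ s₀ g) ei
    s₂ : S (x ∷ p) (lookup C j) ~ S (x ∷ p) (y ∷ q)
    s₂ = set-j (good-~ s₁ g) ej
    g₂ : Good (S (x ∷ p) (y ∷ q))
    g₂ = good-~ s₂ (good-~ s₁ g)
    s₃ : S (x ∷ p) (y ∷ q) ~ S (y ∷ p) (x ∷ q)
    s₃ = subst (S (x ∷ p) (y ∷ q) ~_)
      (≡-trans (cong (_[ j ]≔ (x ∷ q)) (≡-trans ([]≔-commutes (C [ i ]≔ (x ∷ p)) j i (≢-sym i≢j))
                 (cong (_[ j ]≔ (y ∷ q)) ([]≔-idempotent C i))))
               ([]≔-idempotent (C [ i ]≔ (y ∷ p)) j))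
      (tops-swap g₂ i≢j (lookup-update₂ i≢j C (x ∷ p) (y ∷ q)) (lookup∘update j (C [ i ]≔ (x ∷ p)) (y ∷ q)))
    g₃ = good-~ s₃ g₂
    s₄ : S (y ∷ p) (x ∷ q) ~ S a (x ∷ q)
    s₄ = set-i g₃ (↭-sym ea)
    s₅ : S a (x ∷ q) ~ S a b
    s₅ = set-j (good-~ s₄ g₃) (↭-sym eb)

  swapped-~ : ∀ {C E} → Good C → Swapped C E → C ~ E
  swapped-~ g (within j p e refl) = adjacent-swap g j p e
  swapped-~ g (across i≢j p q {x} {y} {r} {t} e e′ refl) = exchange g i≢j
    (trans (↭-reflexive e) (shift x p r)) (shift y p r) (trans (↭-reflexive e′) (shift y q t)) (shift x q t)

  -- Each adjacent interchange in the derivation of `u ↭ v` is a `Swapped` pair of stacks, and those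
  -- are realised by hops.
  permute-word : ∀ ks pre {u v} → u ↭ v → length (pre ++ u) ≡ sum ks → Good (fill ks (pre ++ u)) →
    fill ks (pre ++ u) ~ fill ks (pre ++ v)
  permute-word ks pre refl l g = ε
  permute-word ks pre (prep {xs} {ys} x u↭v) l g =
    subst₂ (λ a b → fill ks a ~ fill ks b) (++-assoc pre [ x ] xs) (++-assoc pre [ x ] ys)
      (permute-word ks (pre ++ [ x ]) u↭v (≡-trans (cong length assoc) l) (subst (Good ∘ fill ks) (sym assoc) g))
    where assoc = ++-assoc pre [ x ] xs
  permute-word ks pre (swap {xs} {ys} x y u↭v) l g =
    s ◅◅ subst₂ (λ a b → fill ks a ~ fill ks b) assoc (++-assoc pre (y ∷ [ x ]) ys)
      (permute-word ks (pre ++ y ∷ [ x ]) u↭v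
        (≡-trans (cong length assoc) (≡-trans (≡-trans (length-++ pre) (sym (length-++ pre))) l))
        (subst (Good ∘ fill ks) (sym assoc) (good-~ s g)))
    where
    assoc = ++-assoc pre (y ∷ [ x ]) xs
    s : fill ks (pre ++ x ∷ y ∷ xs) ~ fill ks (pre ++ y ∷ x ∷ xs)
    s = swapped-~ g (fill-swap ks pre (≤-reflexive l))
  permute-word ks pre (trans {ys = u′} p q) l g =
    s ◅◅ permute-word ks pre q (≡-trans (sym (↭-length (++⁺ˡ pre p))) l) (good-~ s g)
    where
    s : _ ~ fill ks (pre ++ u′)
    s = permute-word ks pre p l g

  -- Adjusting the stack sizes, and connectedness.

  lengths : Vec (List A) n → Fin n → ℕ
  lengths C i = length (lookup C i)

  total-lengths : ∀ {C} → Good C → total (lengths C) ≡ w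
  total-lengths {C} g = ≡-trans (sym (content-length C)) (good-size g)

  -- As the totals agree, a stack above its target size implies one below, and a hop from the former
  -- to the latter lowers the total surplus. The argument `bound` exceeds this surplus and makes the
  -- recursion terminate.
  reshape : ∀ (f : Fin n → ℕ) → (∀ i → f i ≤ lookup c i) → total f ≡ w →
    ∀ bound {C} → Good C → total (λ i → lengths C i ∸ f i) < bound →
    ∃ λ D → C ~ D × (∀ i → lengths D i ≡ f i)
  reshape f f≤c tf (suc bound) {C} g (s≤s lt) with FP.any? (λ i → f i <? lengths C i)
  ... | no all≤ = C , ε , same
    where
    same : ∀ i → lengths C i ≡ f i
    same i with lengths C i <? f i
    ... | yes i< = contradiction (≡-trans (total-lengths g) (sym tf))
                     (<⇒≢ (total-mono-< (lengths C) f (λ k → ≮⇒≥ (λ k> → all≤ (k , k>))) i<))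
    ... | no i≮ = ≤-antisym (≮⇒≥ (λ i> → all≤ (i , i>))) (≮⇒≥ i≮)
  ... | yes (i , i>) with total-≤⇒∃< (lengths C) f (≤-reflexive (≡-trans (total-lengths g) (sym tf))) i>
  ...   | j , j< = go (lookup C i) refl
    where
    i≢j : i ≢ j
    i≢j refl = <-asym i> j<
    go : ∀ u → lookup C i ≡ u → ∃ λ D → C ~ D × (∀ i → lengths D i ≡ f i)
    go [] e = contradiction (subst (λ u → f i < length u) e i>) λ ()
    go (x ∷ a) e = proj₁ rest , s ◅◅ proj₁ (proj₂ rest) , proj₂ (proj₂ rest)
      where
      b = lookup C j
      D = (C [ i ]≔ a) [ j ]≔ (x ∷ b)
      fi≤ : f i ≤ length a
      fi≤ = s≤s⁻¹ (subst (λ u → f i < length u) e i>)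
      s : C ~ D
      s = subst (_~ D) (sym (update₂-self C i j e refl))
        (hop₂ (good-fits g) i j i≢j (fits-at (good-fits g) i e) (<-≤-trans j< (f≤c j)))
      at-i : suc (lengths D i) ≡ lengths C i
      at-i = ≡-trans (cong (suc ∘ length) (lookup-update₂ i≢j C a (x ∷ b))) (cong length (sym e))
      smaller-i : lengths D i ∸ f i < lengths C i ∸ f i
      smaller-i = ≤-reflexive (≡-trans (sym (+-∸-assoc 1 (≤-trans fi≤ (≤-reflexive
        (cong length (sym (lookup-update₂ i≢j C a (x ∷ b)))))))) (cong (_∸ f i) at-i))
      no-larger : ∀ k → lengths D k ∸ f k ≤ lengths C k ∸ f k
      no-larger k with k F.≟ i | k F.≟ j
      ... | yes refl | _ = <⇒≤ smaller-i
      -- The receiving stack was below its target, so even with one more wagon its truncated surplus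
      -- is 0.
      ... | no _ | yes refl = ≤-trans (≤-reflexive (m≤n⇒m∸n≡0
              (≤-trans (≤-reflexive (cong length (lookup∘update j (C [ i ]≔ a) (x ∷ b)))) j<))) z≤n
      ... | no k≢i | no k≢j = ≤-reflexive (cong (λ u → length u ∸ f k)
              (≡-trans (lookup∘update′ k≢j (C [ i ]≔ a) (x ∷ b)) (lookup∘update′ k≢i C a)))
      smaller : total (λ k → lengths D k ∸ f k) < total (λ k → lengths C k ∸ f k)
      smaller = total-mono-< (λ k → lengths D k ∸ f k) (λ k → lengths C k ∸ f k) no-larger smaller-i
      rest = reshape f f≤c tf bound (good-~ s g) (<-≤-trans smaller lt)

  -- After reshaping to the sizes of `D`, both arrangements are cuts of words at the same places,
  -- and the words are permutations of each other.
  connected : ∀ {C D} → Good C → Good D → content C ↭ content D → C ~ D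
  connected {C} {D} gC gD p with reshape (lengths D) (fit (good-fits gD)) (total-lengths gD) _ gC (n<1+n _)
  ... | C′ , r , h = r ◅◅ subst₂ _~_ left (fill-content D)
    (permute-word ks [] p′ l (subst Good (sym left) (good-~ r gC)))
    where
    ks = V.map length D
    left : fill ks (content C′) ≡ C′
    left = ≡-trans (cong (λ v → fill v (content C′)) (lookup-ext λ i →
      ≡-trans (lookup-map i length D) (≡-trans (sym (h i)) (sym (lookup-map i length C′))))) (fill-content C′)
    p′ : content C′ ↭ content D
    p′ = trans (↭-sym (~-content r)) p
    l : length (content C′) ≡ sum ks
    l = ≡-trans (↭-length p′) (≡-trans (content-length D) (cong sum (≡-trans (tabulate-cong λ i →
      sym (lookup-map i length D)) (tabulate∘lookup ks))))

-- Positions, moves and the pulling of a single wagon.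

siding-count : ∀ {w s h} (m : Vec ℕ s) (p : Config w s) → Valid h m p →
  length (headshunt p) + total (λ i → length (siding p i)) ≡ w
siding-count m (hs , sd) (perm , _) = ≡-trans (cong (length hs +_) (sym (content-length sd)))
  (≡-trans (sym (length-++ hs)) (≡-trans (↭-length perm) (length-tabulate (λ x → x))))

reach-trans : ∀ {w s h} {m : Vec ℕ s} {p q r : Config w s} → Reach h m p q → Reach h m q r → Reach h m p r
reach-trans here r₂ = r₂
reach-trans (step v mv r₁) r₂ = step v mv (reach-trans r₁ r₂)

move-sym : ∀ {w s} {p q : Config w s} → Move p q → Move q p
move-sym (p≢q , r , same , eq) = ≢-sym p≢q , r , (λ i i≢r → sym (same i i≢r)) , sym eq

-- Both directions are carried along because `Reach` records validity only for the positions after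
-- the first, so reversing a path would require the validity of its start.
Linked : ∀ {w s} (h : ℕ) (m : Vec ℕ s) (p q : Config w s) → Set
Linked h m p q = Reach h m p q × Reach h m q p

linked-sym : ∀ {w s h} {m : Vec ℕ s} {p q : Config w s} → Linked h m p q → Linked h m q p
linked-sym (a , b) = b , a

linked-trans : ∀ {w s h} {m : Vec ℕ s} {p q r : Config w s} → Linked h m p q → Linked h m q r → Linked h m p r
linked-trans (a , b) (c , d) = reach-trans a c , reach-trans d b

linked-reflexive : ∀ {w s h} {m : Vec ℕ s} {p q : Config w s} → p ≡ q → Linked h m p q
linked-reflexive refl = here , here

x∷a≢a : ∀ {A : Set} {x : A} {a} → x ∷ a ≢ a
x∷a≢a eq = 1+n≢n (cong length eq)

-- One wagon passes the points into the headshunt. All paths of the positive direction are built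
-- from this move and its inverse.
pull : ∀ {w s h} {m : Vec ℕ s} {hs : List (Fin w)} {sd i x a} →
  Valid h m (hs , sd) → length hs < h → lookup sd i ≡ x ∷ a →
  Valid h m (hs ∷ʳ x , sd [ i ]≔ a) × Linked h m (hs , sd) (hs ∷ʳ x , sd [ i ]≔ a)
pull {w} {s} {h} {m} {hs} {sd} {i} {x} {a} v@(perm , lh , ls) lt e = v′ , step v′ mv here , step v (move-sym mv) here
  where
  v′ : Valid h m (hs ∷ʳ x , sd [ i ]≔ a)
  v′ = trans (↭-reflexive (++-assoc hs [ x ] (content (sd [ i ]≔ a))))
         (trans (++⁺ˡ hs (↭-sym (content-extract sd i (↭-reflexive e)))) perm)
     , ≤-trans (≤-reflexive (≡-trans (length-++ hs) (+-comm (length hs) 1))) lt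
     , bound
    where
    bound : ∀ k → length (lookup (sd [ i ]≔ a) k) ≤ lookup m k
    bound k with k F.≟ i
    ... | yes refl = subst (λ u → length u ≤ lookup m k) (sym (lookup∘update k sd a))
                       (≤-trans (n≤1+n _) (subst (λ u → length u ≤ lookup m k) e (ls k)))
    ... | no k≢i = subst (λ u → length u ≤ lookup m k) (sym (lookup∘update′ k≢i sd a)) (ls k)
  mv : Move (hs , sd) (hs ∷ʳ x , sd [ i ]≔ a)
  mv = (λ eq → x∷a≢a (≡-trans (sym e) (≡-trans (cong (λ c → lookup (proj₂ c) i) eq) (lookup∘update i sd a))))
     , i , (λ k k≢i → sym (lookup∘update′ k≢i sd a))
     , ≡-trans (cong (hs ++_) e) (≡-trans (sym (++-assoc hs [ x ] a))
         (cong ((hs ∷ʳ x) ++_) (sym (lookup∘update i sd a))))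

-- Simulating the stacks in the inglenook.

module Simulation {w s h′ : ℕ} (m : Vec ℕ s)
  (third : ∀ (i j : Fin (suc s)) → ∃ λ k → k ≢ i × k ≢ j × 1 ≤ lookup (h′ ∷ m) k)
  (roomy : ∀ j → w + lookup (h′ ∷ m) j ≤ sum (h′ ∷ m)) where

  open Stacks {Fin w} (h′ ∷ m) w third roomy

  -- A stack is accessible at its front, whereas the headshunt is listed from the engine and
  -- accessible at its end; hence the reversal.
  encode : Vec (List (Fin w)) (suc s) → Config w s
  encode (a ∷ sd) = L.reverse a , sd

  encode-valid : ∀ {C} → Fits C → content C ↭ allFin w → Valid (suc h′) m (encode C)
  encode-valid {a ∷ sd} f p = trans (++⁺ʳ (content sd) (↭-reverse a)) p
    , ≤-trans (≤-reflexive (length-reverse a)) (m≤n⇒m≤1+n (fit f zero)) , λ i → fit f (suc i)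

  -- A hop onto or off stack 0 is one pull or its inverse. A hop between sidings is a pull followed
  -- by an inverse pull through the spare last place of the headshunt.
  hop-linked : ∀ {C D} → Hop C D → content C ↭ allFin w → Linked (suc h′) m (encode C) (encode D)
  hop-linked {a ∷ sd} {b ∷ sd′} hop@(hopping {zero} {zero} d _ _ _ _ _) p = contradiction refl d
  hop-linked {a ∷ sd} {b ∷ sd′} hop@(hopping {suc i} {zero} {x} d s t e f f′) p =
    linked-trans (proj₂ (pull (encode-valid f p) (s≤s (≤-trans (≤-reflexive (length-reverse a)) (fit f zero))) s))
      (linked-reflexive (cong₂ _,_ (≡-trans (sym (unfold-reverse x a)) (cong L.reverse (sym t))) (lookup-ext same)))
    where
    same : ∀ k → lookup (sd [ i ]≔ lookup sd′ i) k ≡ lookup sd′ k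
    same k with k F.≟ i
    ... | yes refl = lookup∘update k sd (lookup sd′ k)
    ... | no k≢i = ≡-trans (lookup∘update′ k≢i sd (lookup sd′ i)) (e (suc k) (k≢i ∘ FP.suc-injective) λ ())
  hop-linked {a ∷ sd} {b ∷ sd′} hop@(hopping {zero} {suc j} {x} d s t e f f′) p =
    linked-trans (linked-reflexive (cong₂ _,_ (≡-trans (cong L.reverse s) (unfold-reverse x b)) (sym (lookup-ext same))))
      (linked-sym (proj₂ (pull (encode-valid f′ (trans (↭-sym (hop-content hop)) p))
        (s≤s (≤-trans (≤-reflexive (length-reverse b)) (fit f′ zero))) t)))
    where
    same : ∀ k → lookup (sd′ [ j ]≔ lookup sd j) k ≡ lookup sd k
    same k with k F.≟ j
    ... | yes refl = lookup∘update k sd′ (lookup sd k)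
    ... | no k≢j = ≡-trans (lookup∘update′ k≢j sd′ (lookup sd j)) (sym (e (suc k) (λ ()) (k≢j ∘ FP.suc-injective)))
  hop-linked {a ∷ sd} {b ∷ sd′} hop@(hopping {suc i} {suc j} {x} d s t e f f′) p =
    linked-trans (proj₂ (pull (encode-valid f p) (s≤s (≤-trans (≤-reflexive (length-reverse a)) (fit f zero))) s))
      (linked-trans (linked-reflexive (cong₂ _,_ (cong (λ u → L.reverse u ∷ʳ x) (e zero (λ ()) λ ())) (lookup-ext same)))
        (linked-sym (proj₂ (pull (encode-valid f′ (trans (↭-sym (hop-content hop)) p))
          (s≤s (≤-trans (≤-reflexive (length-reverse b)) (fit f′ zero))) t))))
    where
    same : ∀ k → lookup (sd [ i ]≔ lookup sd′ i) k ≡ lookup (sd′ [ j ]≔ lookup sd j) k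
    same k with k F.≟ i | k F.≟ j
    ... | yes refl | _ = ≡-trans (lookup∘update k sd (lookup sd′ k))
                           (sym (lookup∘update′ (d ∘ cong suc) sd′ (lookup sd j)))
    ... | no k≢i | yes refl = ≡-trans (lookup∘update′ k≢i sd (lookup sd′ i)) (sym (lookup∘update k sd′ (lookup sd k)))
    ... | no k≢i | no k≢j = ≡-trans (lookup∘update′ k≢i sd (lookup sd′ i))
          (≡-trans (e (suc k) (k≢i ∘ FP.suc-injective) (k≢j ∘ FP.suc-injective))
            (sym (lookup∘update′ k≢j sd′ (lookup sd j))))

  ~-reach : ∀ {C D} → C ~ D → content C ↭ allFin w → Reach (suc h′) m (encode C) (encode D)
  ~-reach ε p = here
  ~-reach (hop ◅ r) p =
    reach-trans (proj₁ (hop-linked hop p)) (~-reach r (trans (↭-sym (hop-content hop)) p))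

  -- Only a full headshunt lacks the spare place. Then `w < h + sum m` gives a siding with room, and
  -- pushing the wagon nearest the points into it yields an encoded position.
  decode : ∀ {p} → w < suc h′ + sum m → Valid (suc h′) m p →
    ∃ λ C → Good C × content C ↭ allFin w × Linked (suc h′) m p (encode C)
  decode {hs , sd} w< v@(perm , lh , ls) with length hs ≤? h′
  ... | yes l = L.reverse hs ∷ sd , good (fitting fits) (≡-trans (↭-length p) (length-tabulate (λ x → x)))
        , p , linked-reflexive (cong (_, sd) (sym (reverse-involutive hs)))
    where
    p : content (L.reverse hs ∷ sd) ↭ allFin w
    p = trans (++⁺ʳ (content sd) (↭-reverse hs)) perm
    fits : ∀ i → length (lookup (L.reverse hs ∷ sd) i) ≤ lookup (h′ ∷ m) i
    fits zero = ≤-trans (≤-reflexive (length-reverse hs)) l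
    fits (suc i) = ls i
  ... | no h′<hs with total-<⇒∃< (λ i → length (lookup sd i)) (lookup m) (+-cancelˡ-< (suc h′) _ _ (begin-strict
      suc h′ + total (λ i → length (lookup sd i))     ≡⟨ cong (_+ total (λ i → length (lookup sd i))) (sym full) ⟩
      length hs + total (λ i → length (lookup sd i))  ≡⟨ siding-count m (hs , sd) v ⟩
      w                                               <⟨ w< ⟩
      suc h′ + sum m                                  ≡⟨ cong (suc h′ +_) (sym (total-lookup m)) ⟩
      suc h′ + total (lookup m)                       ∎))
    where
    open ≤-Reasoning
    full : length hs ≡ suc h′
    full = ≤-antisym lh (≰⇒> h′<hs)
  ...   | r , lr = go (L.reverse hs) refl
    where
    go : ∀ u → L.reverse hs ≡ u → ∃ λ C → Good C × content C ↭ allFin w × Linked (suc h′) m (hs , sd) (encode C)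
    go [] e = contradiction (≡-trans (sym (length-reverse hs)) (cong length e))
                λ z → h′<hs (≤-trans (≤-reflexive z) z≤n)
    go (x ∷ a) e = a ∷ sd′ , good f (≡-trans (↭-length p) (length-tabulate (λ x → x))) , p
      , linked-trans (linked-reflexive (cong₂ _,_ hs≡ (sym sd≡)))
          (linked-sym (proj₂ (pull (encode-valid f p) (s≤s (≤-trans (≤-reflexive (length-reverse a)) la))
            (lookup∘update r sd (x ∷ lookup sd r)))))
      where
      sd′ = sd [ r ]≔ (x ∷ lookup sd r)
      hs≡ : hs ≡ L.reverse a ∷ʳ x
      hs≡ = ≡-trans (sym (reverse-involutive hs)) (≡-trans (cong L.reverse e) (unfold-reverse x a))
      sd≡ : sd′ [ r ]≔ lookup sd r ≡ sd
      sd≡ = ≡-trans ([]≔-idempotent sd r) ([]≔-lookup sd r)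
      la : length a ≤ h′
      la = s≤s⁻¹ (≤-trans (≤-reflexive (≡-trans (cong length (sym e)) (length-reverse hs))) lh)
      f : Fits (a ∷ sd′)
      f = fitting bound
        where
        bound : ∀ i → length (lookup (a ∷ sd′) i) ≤ lookup (h′ ∷ m) i
        bound zero = la
        bound (suc k) with k F.≟ r
        ... | yes refl = subst (λ u → length u ≤ lookup m k) (sym (lookup∘update k sd (x ∷ lookup sd k))) lr
        ... | no k≢r = subst (λ u → length u ≤ lookup m k) (sym (lookup∘update′ k≢r sd (x ∷ lookup sd r))) (ls k)
      p : content (a ∷ sd′) ↭ allFin w
      p = trans (++⁺ˡ a (content-extract sd′ r (↭-reflexive (lookup∘update r sd (x ∷ lookup sd r)))))
        (trans (↭-reflexive (cong (λ D → a ++ x ∷ content D) sd≡))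
        (trans (shift x a (content sd))
        (trans (++⁺ʳ (content sd) (trans (↭-reflexive (sym e)) (↭-reverse hs))) perm)))

  reachable : ∀ {p q} → w < suc h′ + sum m → Valid (suc h′) m p → Valid (suc h′) m q → Reach (suc h′) m p q
  reachable w< vp vq with decode w< vp | decode w< vq
  ... | C , gC , pC , p↔C | D , gD , pD , q↔D =
    reach-trans (proj₁ p↔C) (reach-trans (~-reach (connected gC gD (trans pC (↭-sym pD))) pC) (proj₂ q↔D))

-- The solvable cases.

distinct-third : ∀ {n} (i j : Fin (3 + n)) → ∃ λ k → k ≢ i × k ≢ j
distinct-third zero zero = suc zero , (λ ()) , (λ ())
distinct-third zero (suc zero) = suc (suc zero) , (λ ()) , (λ ())
distinct-third zero (suc (suc j)) = suc zero , (λ ()) , (λ ())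
distinct-third (suc zero) zero = suc (suc zero) , (λ ()) , (λ ())
distinct-third (suc (suc i)) zero = suc zero , (λ ()) , (λ ())
distinct-third (suc i) (suc j) = zero , (λ ()) , (λ ())

lookup-≥1 : ∀ {n} {m : Vec ℕ n} → All (1 ≤_) m → ∀ i → 1 ≤ lookup m i
lookup-≥1 (p ∷ ps) zero = p
lookup-≥1 (p ∷ ps) (suc i) = lookup-≥1 ps i

init≤foldr-⊔ : ∀ {n} e (m : Vec ℕ n) → e ≤ foldr′ _⊔_ e m
init≤foldr-⊔ e [] = ≤-refl
init≤foldr-⊔ e (x ∷ m) = ≤-trans (init≤foldr-⊔ e m) (m≤n⊔m x _)

lookup≤foldr-⊔ : ∀ {n} e (m : Vec ℕ n) i → lookup m i ≤ foldr′ _⊔_ e m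
lookup≤foldr-⊔ e (x ∷ m) zero = m≤m⊔n x _
lookup≤foldr-⊔ e (x ∷ m) (suc i) = ≤-trans (lookup≤foldr-⊔ e m i) (m≤n⊔m x _)

star⇒roomy : ∀ {w s h′} (m : Vec ℕ s) → Star w (suc h′) m → ∀ j → w + lookup (h′ ∷ m) j ≤ sum (h′ ∷ m)
star⇒roomy {w} {h′ = h′} m st zero = ≤-trans (+-monoʳ-≤ w (init≤foldr-⊔ h′ m)) st
star⇒roomy {w} {h′ = h′} m st (suc j) = ≤-trans (+-monoʳ-≤ w (lookup≤foldr-⊔ h′ m j)) st

content-[] : ∀ {A : Set} {n} (C : Vec (List A) n) → content C ≡ [] → C ≡ replicate n []
content-[] [] e = refl
content-[] ([] ∷ C) e = cong ([] ∷_) (content-[] C e)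

content-∷ : ∀ {A : Set} {n} (C : Vec (List A) n) {x r} → content C ≡ x ∷ r → ∃ λ i → ∃₂ λ y a → lookup C i ≡ y ∷ a
content-∷ ([] ∷ C) e with content-∷ C e
... | i , y , a , eq = suc i , y , a , eq
content-∷ ((y ∷ a) ∷ C) e = zero , y , a , refl

-- A common meeting point: with one wagon, every position is at most one pull away from it.
gather : ∀ {s h} {m : Vec ℕ s} {p : Config 1 s} → 1 ≤ h → Valid h m p → Linked h m p ([ zero ] , replicate s [])
gather {p = [] , sd} 1≤h v@(perm , _) with content-∷ sd (↭-singleton-inv perm)
... | i , zero , a , e = linked-trans (proj₂ (pull v 1≤h e)) (linked-reflexive (cong ([ zero ] ,_)
        (content-[] (sd [ i ]≔ a) (↭-empty-inv (drop-∷ (trans (↭-sym (content-extract sd i (↭-reflexive e))) perm))))))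
gather {p = x ∷ hs , sd} 1≤h (perm , _) with ∷-injective (↭-singleton-inv perm)
... | x≡ , rest = linked-reflexive
  (cong₂ _,_ (cong₂ _∷_ x≡ (++-conicalˡ hs _ rest)) (content-[] sd (++-conicalʳ hs _ rest)))

solvable : ∀ {w s h} (m : Vec ℕ s) → 1 ≤ h → All (1 ≤_) m → w < h + sum m → SolvableCase w s h m →
  ∀ {p q : Config w s} → Valid h m p → Valid h m q → Reach h m p q
solvable m 1≤h m≥1 w< (inj₁ (_ , s≤s (s≤s (z≤n {s})) , s≤s (s≤s (z≤n {h})) , st)) =
  reachable w<
  where
  -- With only two sidings the third stack may be stack 0, whose capacity is positive because the
  -- headshunt has length at least 2.
  third : ∀ (i j : Fin (3 + s)) → ∃ λ k → k ≢ i × k ≢ j × 1 ≤ lookup (suc h ∷ m) k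
  third i j with distinct-third i j
  ... | k , k≢i , k≢j = k , k≢i , k≢j , lookup-≥1 (s≤s z≤n ∷ m≥1) k
  open Simulation m third (star⇒roomy m st)
solvable m 1≤h m≥1 w< (inj₂ (inj₁ (_ , s≤s (s≤s (s≤s (z≤n {s}))) , refl , st))) =
  reachable w<
  where
  -- With h = 1 stack 0 has capacity 0, so the third stack has to be a siding.
  siding-of : Fin (4 + s) → Fin (3 + s)
  siding-of zero = zero
  siding-of (suc i) = i
  avoid : ∀ {k} i → k ≢ siding-of i → suc k ≢ i
  avoid (suc i) k≢ refl = k≢ refl
  third : ∀ (i j : Fin (4 + s)) → ∃ λ k → k ≢ i × k ≢ j × 1 ≤ lookup (0 ∷ m) k
  third i j with distinct-third (siding-of i) (siding-of j)
  ... | k , k≢i , k≢j = suc k , avoid i k≢i , avoid j k≢j , lookup-≥1 m≥1 k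
  open Simulation m third (star⇒roomy m st)
solvable m 1≤h m≥1 w< (inj₂ (inj₂ refl)) vp vq = reach-trans (proj₁ (gather 1≤h vp)) (proj₂ (gather 1≤h vq))

-- Ends of lists, relabelling of wagons and disjointness of tracks.

last-++-∷ : ∀ {A : Set} (xs : List A) y ys → last (xs ++ y ∷ ys) ≡ last (y ∷ ys)
last-++-∷ [] y ys = refl
last-++-∷ (x ∷ []) y ys = refl
last-++-∷ (x ∷ x′ ∷ xs) y ys = last-++-∷ (x′ ∷ xs) y ys

last-++-just : ∀ {A : Set} (xs : List A) {ys y} → last ys ≡ just y → last (xs ++ ys) ≡ just y
last-++-just xs {y′ ∷ ys} e = ≡-trans (last-++-∷ xs y′ ys) e

last-defined : ∀ {A : Set} {xs : List A} → xs ≢ [] → ∃ λ x → last xs ≡ just x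
last-defined {xs = []} ne = contradiction refl ne
last-defined {xs = x ∷ []} ne = x , refl
last-defined {xs = x ∷ x′ ∷ xs} ne = last-defined {xs = x′ ∷ xs} λ ()

last-∈ : ∀ {A : Set} {xs : List A} {x} → last xs ≡ just x → x ∈ xs
last-∈ {xs = x ∷ []} refl = here refl
last-∈ {xs = x ∷ x′ ∷ xs} e = there (last-∈ {xs = x′ ∷ xs} e)

∈-extract : ∀ {A : Set} {xs : List A} {x} → x ∈ xs → ∃ λ a → xs ↭ x ∷ a
∈-extract {x = x} x∈ with ∈-∃++ x∈
... | ys , zs , refl = ys ++ zs , shift x ys zs

++-injectiveˡ : ∀ {A : Set} (xs : List A) {xs′ ys ys′} → length xs ≡ length xs′ → xs ++ ys ≡ xs′ ++ ys′ → xs ≡ xs′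
++-injectiveˡ [] {[]} l e = refl
++-injectiveˡ (x ∷ xs) {x′ ∷ xs′} l e =
  cong₂ _∷_ (∷-injectiveˡ e) (++-injectiveˡ xs (suc-injective l) (∷-injectiveʳ e))

allFin-no-repeat : ∀ {w} {x : Fin w} {r} → ¬ (x ∷ x ∷ r ↭ allFin w)
allFin-no-repeat {w} p with PermS.Unique-resp-↭ (setoid (Fin w)) (↭⇒↭ₛ (↭-sym p)) (Unique.allFin⁺ w)
... | (x≢x ∷ _) ∷ _ = x≢x refl

-- Both lists are free of repetition and have the same elements; for such lists equality as sets is
-- already equality as bags.
permute-allFin : ∀ {w} (σ : Permutation′ w) → L.map (σ ⟨$⟩ʳ_) (allFin w) ↭ allFin w
permute-allFin {w} σ = ∼bag⇒↭ (unique∧set⇒bag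
  (Unique.map⁺ (λ {x} {y} e → ≡-trans (sym (inverseˡ σ)) (≡-trans (cong (σ ⟨$⟩ˡ_) e) (inverseˡ σ))) (Unique.allFin⁺ w))
  (Unique.allFin⁺ w)
  (λ {x} → mk⇔ (λ _ → ∈-allFin x) (λ _ → subst (_∈ L.map (σ ⟨$⟩ʳ_) (allFin w)) (inverseʳ σ) (∈-map⁺ _ (∈-allFin _)))))

content-map : ∀ {A B : Set} {n} (f : A → B) (C : Vec (List A) n) → content (V.map (L.map f) C) ≡ L.map f (content C)
content-map f [] = refl
content-map f (c ∷ C) = ≡-trans (cong (L.map f c ++_) (content-map f C)) (sym (map-++ f c (content C)))

content-empty : ∀ {A : Set} {n} (C : Vec (List A) n) → (∀ i → lookup C i ≡ []) → content C ≡ []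
content-empty [] e = refl
content-empty (c ∷ C) e = cong₂ _++_ (e zero) (content-empty C (e ∘ suc))

permute-valid : ∀ {w s h} (m : Vec ℕ s) (σ : Permutation′ w) p → Valid h m p → Valid h m (permuteConfig σ p)
permute-valid m σ (hs , sd) (perm , lh , ls) =
    trans (↭-reflexive (≡-trans (cong (L.map f hs ++_) (content-map f sd)) (sym (map-++ f hs (content sd)))))
      (trans (map⁺ f perm) (permute-allFin σ))
  , ≤-trans (≤-reflexive (length-map f hs)) lh
  , λ i → ≤-trans (≤-reflexive (≡-trans (cong length (lookup-map i (L.map f) sd)) (length-map f (lookup sd i)))) (ls i)
  where f = σ ⟨$⟩ʳ_

transpose-source : ∀ {n} (i j : Fin n) → transpose i j ⟨$⟩ʳ i ≡ j
transpose-source i j with i F.≟ i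
... | yes _ = refl
... | no i≢i = contradiction refl i≢i

another : ∀ {w} → 1 < w → (x : Fin w) → ∃ λ y → y ≢ x
another (s≤s (s≤s _)) zero = suc zero , λ ()
another (s≤s (s≤s _)) (suc x) = zero , λ ()

headshunt-siding-disjoint : ∀ {w s h} (m : Vec ℕ s) (p : Config w s) → Valid h m p → ∀ {z x} →
  x ∈ headshunt p → ¬ (x ∈ siding p z)
headshunt-siding-disjoint m (hs , sd) (perm , _) {z} {x} x∈hs x∈z with ∈-extract x∈hs | ∈-extract x∈z
... | a , pa | b , pb = allFin-no-repeat
  (trans (prep x (↭-sym (shift x a _))) (trans (↭-sym (++⁺ pa (content-extract sd z pb))) perm))

siding-siding-disjoint : ∀ {w s h} (m : Vec ℕ s) (p : Config w s) → Valid h m p → ∀ {y z x} → y ≢ z →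
  x ∈ siding p y → ¬ (x ∈ siding p z)
siding-siding-disjoint m (hs , sd) (perm , _) {y} {z} {x} y≢z x∈y x∈z with ∈-extract x∈y | ∈-extract x∈z
... | a , pa | b , pb = allFin-no-repeat
  (trans (↭-sym (shifts hs (x ∷ [ x ])))
    (trans (++⁺ˡ hs (↭-sym (trans (content-extract sd y pa) (prep x (content-extract (sd [ y ]≔ a) z
      (trans (↭-reflexive (lookup∘update′ (≢-sym y≢z) sd a)) pb)))))) perm))

nonempty-somewhere : ∀ {w s h} (m : Vec ℕ s) (p : Config w s) → 1 ≤ w → Valid h m p →
  headshunt p ≡ [] → ¬ (∀ i → siding p i ≡ [])
nonempty-somewhere m (hs , sd) 1≤w (perm , _) e es = contradiction
  (≡-trans (sym (≡-trans (↭-length perm) (length-tabulate (λ x → x)))) (cong length (cong₂ _++_ e (content-empty sd es))))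
  (≢-sym (<⇒≢ 1≤w))

-- Relabelling the starting position moves the value of an equivariant invariant to any wagon.
obstruction : ∀ {w s h} {m : Vec ℕ s} {S F : Config w s → Set} (inv : Config w s → Maybe (Fin w)) →
  (∀ σ p → inv (permuteConfig σ p) ≡ M.map (σ ⟨$⟩ʳ_) (inv p)) →
  (∀ p q → Valid h m p → Valid h m q → Move p q → inv p ≡ inv q) →
  (∀ p → Valid h m p → ∃ λ x → inv p ≡ just x) →
  (∃ λ y → ∀ q → Valid h m q → F q → inv q ≢ just y) →
  (∀ (σ : Permutation′ w) p → Valid h m p → S p → S (permuteConfig σ p)) →
  ∃[ p ] (Valid h m p × S p) → ¬ AlwaysSolvable h m S F
obstruction {h = h} {m} inv equivariant preserved defined (y , avoids) closed (p , vp , Sp) solve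
  with defined p vp
... | x , ex with solve (permuteConfig (transpose x y) p) (permute-valid m (transpose x y) p vp) (closed (transpose x y) p vp Sp)
...   | q , vq , Fq , r = avoids q vq Fq (≡-trans (sym (constant (permuteConfig (transpose x y) p) (permute-valid m (transpose x y) p vp) r))
          (≡-trans (equivariant (transpose x y) p) (≡-trans (cong (M.map _) ex) (cong just (transpose-source x y)))))
  where
  constant : ∀ a {b} → Valid h m a → Reach h m a b → inv a ≡ inv b
  constant a va here = refl
  constant a va (step {c' = b} vb mv r) = ≡-trans (preserved a b va vb mv) (constant b vb r)

-- Invariants in the unsolvable cases.

module Unsolvable {w s h : ℕ} {m : Vec ℕ s} {S F : Config w s → Set} (1<w : 1 < w)
  (natural : Natural h m S F) (start : ∃[ p ] (Valid h m p × S p)) where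

  z : Fin s
  z = proj₁ (proj₂ natural)

  ω : Fin w
  ω = proj₁ (proj₂ (proj₂ natural))

  final : ∀ q → Valid h m q → F q → last (siding q z) ≡ just ω
  final = proj₂ (proj₂ (proj₂ natural))

  -- As `1 < w`, there is a wagon other than `ω`, and an invariant that equals `ω` at every
  -- finishing position never takes it there.
  forced : (inv : Config w s → Maybe (Fin w)) → (∀ q → Valid h m q → last (siding q z) ≡ just ω → inv q ≡ just ω) →
    ∃ λ y → ∀ q → Valid h m q → F q → inv q ≢ just y
  forced inv f with another 1<w ω
  ... | y , y≢ω = y , λ q vq Fq e → y≢ω (just-injective (≡-trans (sym e) (f q vq (final q vq Fq))))

  -- The end of the headshunt-siding-j line never changes: either j is the only siding, or a move on
  -- another siding finds j occupied, or j is empty and then the headshunt is full and stays so.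
  fixed-end : (j : Fin s) →
    (∀ p q → Valid h m p → Valid h m q → siding p j ≡ [] → siding q j ≡ [] →
       ∀ r → r ≢ j → length (headshunt p) ≡ length (headshunt q)) →
    (∀ p → Valid h m p → siding p j ≡ [] → headshunt p ≢ []) →
    ¬ AlwaysSolvable h m S F
  fixed-end j full occupied = obstruction inv equivariant preserved defined target (proj₁ natural) start
    where
    inv : Config w s → Maybe (Fin w)
    inv p = last (headshunt p ++ siding p j)
    equivariant : ∀ σ p → inv (permuteConfig σ p) ≡ M.map (σ ⟨$⟩ʳ_) (inv p)
    equivariant σ p = ≡-trans (cong last (≡-trans (cong (L.map f (headshunt p) ++_) (lookup-map j (L.map f) (proj₂ p)))
      (sym (map-++ f (headshunt p) (siding p j))))) (last-map f (headshunt p ++ siding p j))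
      where f = σ ⟨$⟩ʳ_
    defined : ∀ p → Valid h m p → ∃ λ x → inv p ≡ just x
    defined p vp = last-defined λ e →
      occupied p vp (++-conicalʳ (headshunt p) _ e) (++-conicalˡ (headshunt p) _ e)
    preserved : ∀ p q → Valid h m p → Valid h m q → Move p q → inv p ≡ inv q
    preserved p q vp vq (_ , r , same , eq) with r F.≟ j
    ... | yes refl = cong last eq
    ... | no r≢j = go (siding p j) refl
      where
      pj≡qj : siding p j ≡ siding q j
      pj≡qj = same j (≢-sym r≢j)
      go : ∀ u → siding p j ≡ u → inv p ≡ inv q
      go [] e = cong last (cong₂ _++_
        (++-injectiveˡ (headshunt p) {headshunt q} (full p q vp vq e (≡-trans (sym pj≡qj) e) r r≢j) eq) pj≡qj)
      go (x ∷ a) e = ≡-trans (at p e) (sym (at q (≡-trans (sym pj≡qj) e)))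
        where
        at : ∀ c → siding c j ≡ x ∷ a → inv c ≡ last (x ∷ a)
        at c e′ = ≡-trans (cong (λ u → last (headshunt c ++ u)) e′) (last-++-∷ (headshunt c) x a)
    -- For `j ≡ z` the finishing value is always `ω`. Otherwise `ω` itself is the missed value,
    -- since it stands in siding `z`, off this line.
    target : ∃ λ y → ∀ q → Valid h m q → F q → inv q ≢ just y
    target with j F.≟ z
    ... | yes refl = forced inv λ q _ → last-++-just (headshunt q)
    ... | no j≢z = ω , λ q vq Fq e → elsewhere q vq (last-∈ (final q vq Fq)) (∈-++⁻ (headshunt q) (last-∈ e))
      where
      elsewhere : ∀ q → Valid h m q → ω ∈ siding q z → ¬ (ω ∈ headshunt q ⊎ ω ∈ siding q j)
      elsewhere q vq ∈z (inj₁ ∈hs) = headshunt-siding-disjoint m q vq ∈hs ∈z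
      elsewhere q vq ∈z (inj₂ ∈j) = siding-siding-disjoint m q vq j≢z ∈j ∈z

  single-siding : s ≡ 1 → ¬ AlwaysSolvable h m S F
  single-siding refl = fixed-end z (λ _ _ _ _ _ _ r r≢z → contradiction (unique r z) r≢z)
    (λ p vp e e′ → nonempty-somewhere m p (<⇒≤ 1<w) vp e′ λ i → subst (λ k → siding p k ≡ []) (unique z i) e)
    where
    unique : ∀ (i j : Fin 1) → i ≡ j
    unique zero zero = refl

  -- While siding `j` is empty, the rest of the track has at most `w` places, so all of it is full,
  -- the headshunt included.
  large-siding : 1 ≤ h → (j : Fin s) → h + sum m ≤ w + lookup m j → ¬ AlwaysSolvable h m S F
  large-siding 1≤h j le = fixed-end j
    (λ p q vp vq e e′ _ _ → ≡-trans (full p vp e) (sym (full q vq e′)))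
    (λ p vp e e′ → <⇒≢ 1≤h (≡-trans (cong length (sym e′)) (full p vp e)))
    where
    full : ∀ p → Valid h m p → siding p j ≡ [] → length (headshunt p) ≡ h
    full p vp@(_ , lh , ls) e = ≤-antisym lh (+-cancelʳ-≤ (sum m) _ _ (begin
      h + sum m                           ≤⟨ le ⟩
      w + lookup m j                      ≡⟨ cong (_+ lookup m j) (sym (siding-count m p vp)) ⟩
      (hl + total len) + lookup m j       ≡⟨ +-assoc hl _ _ ⟩
      hl + (total len + lookup m j)       ≡⟨ cong (hl +_) (sym (total-update len j (lookup m j))) ⟩
      hl + (total len′ + len j)           ≡⟨ cong (λ u → hl + (total len′ + length u)) e ⟩
      hl + (total len′ + 0)               ≡⟨ cong (hl +_) (+-identityʳ _) ⟩
      hl + total len′                     ≤⟨ +-monoʳ-≤ hl (total-mono-≤ len′ (lookup m) bound) ⟩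
      hl + total (lookup m)               ≡⟨ cong (hl +_) (total-lookup m) ⟩
      hl + sum m                          ∎))
      where
      open ≤-Reasoning
      hl = length (headshunt p)
      len : Fin s → ℕ
      len i = length (siding p i)
      -- The empty siding `j` is counted as full, which turns the bound on the other sidings into
      -- the bound `sum m`.
      len′ = updateAt len j (const (lookup m j))
      bound : ∀ i → len′ i ≤ lookup m i
      bound i with i F.≟ j
      ... | yes refl = ≤-reflexive (updateAt-updates i len)
      ... | no i≢j = ≤-trans (≤-reflexive (updateAt-minimal i j len i≢j)) (ls i)

  -- The headshunt is never empty, so the wagon next to the engine never moves.
  small-sidings : sum m < w → ¬ AlwaysSolvable h m S F
  small-sidings lt = obstruction (head ∘ headshunt)
    (λ σ p → head-map (headshunt p))
    preserved defined (ω , avoids) (proj₁ natural) start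
    where
    occupied : ∀ p → Valid h m p → headshunt p ≢ []
    occupied p vp@(_ , _ , ls) e = <⇒≱ lt (begin
      w                                                        ≡⟨ sym (siding-count m p vp) ⟩
      length (headshunt p) + total (λ i → length (siding p i)) ≡⟨ cong (λ u → length u + total (λ i → length (siding p i))) e ⟩
      total (λ i → length (siding p i))                        ≤⟨ total-mono-≤ _ (lookup m) ls ⟩
      total (lookup m)                                         ≡⟨ total-lookup m ⟩
      sum m                                                    ∎)
      where open ≤-Reasoning
    preserved : ∀ p q → Valid h m p → Valid h m q → Move p q → head (headshunt p) ≡ head (headshunt q)
    preserved p@([] , _) q vp vq mv = contradiction refl (occupied p vp)
    preserved (x ∷ _ , _) q@([] , _) vp vq mv = contradiction refl (occupied q vq)
    preserved (x ∷ _ , _) (y ∷ _ , _) vp vq (_ , _ , _ , eq) = cong just (∷-injectiveˡ eq)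
    defined : ∀ p → Valid h m p → ∃ λ x → head (headshunt p) ≡ just x
    defined p@([] , _) vp = contradiction refl (occupied p vp)
    defined (x ∷ _ , _) vp = x , refl
    avoids : ∀ q → Valid h m q → F q → head (headshunt q) ≢ just ω
    avoids q@(x ∷ _ , _) vq Fq refl = headshunt-siding-disjoint m q vq (here refl) (last-∈ (final q vq Fq))

  -- With h = 1 and two sidings the wagons form a single line, read through siding o backwards,
  -- the headshunt and siding z, along which no wagon can overtake another.
  two-sidings : h ≡ 1 → s ≡ 2 → ¬ AlwaysSolvable h m S F
  two-sidings refl refl = obstruction inv equivariant preserved defined (forced inv target) (proj₁ natural) start
    where
    opposite : (i : Fin 2) → ∃ λ o → o ≢ i × (∀ r → r ≢ i → r ≡ o)
    opposite zero = suc zero , (λ ()) , λ { zero r≢ → contradiction refl r≢ ; (suc zero) _ → refl }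
    opposite (suc zero) = zero , (λ ()) , λ { zero _ → refl ; (suc zero) r≢ → contradiction refl r≢ }
    o : Fin 2
    o = proj₁ (opposite z)
    o≢z = proj₁ (proj₂ (opposite z))
    line : Config w 2 → List (Fin w)
    line p = L.reverse (siding p o) ++ headshunt p ++ siding p z
    inv : Config w 2 → Maybe (Fin w)
    inv p = last (line p)
    equivariant : ∀ σ p → inv (permuteConfig σ p) ≡ M.map (σ ⟨$⟩ʳ_) (inv p)
    equivariant σ p@(hs , sd) = ≡-trans (cong last (begin
      L.reverse (lookup (V.map (L.map f) sd) o) ++ L.map f hs ++ lookup (V.map (L.map f) sd) z
        ≡⟨ cong₂ (λ u v → L.reverse u ++ L.map f hs ++ v) (lookup-map o (L.map f) sd) (lookup-map z (L.map f) sd) ⟩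
      L.reverse (L.map f (lookup sd o)) ++ L.map f hs ++ L.map f (lookup sd z)
        ≡⟨ cong₂ _++_ (sym (reverse-map f (lookup sd o))) (sym (map-++ f hs (lookup sd z))) ⟩
      L.map f (L.reverse (lookup sd o)) ++ L.map f (hs ++ lookup sd z)
        ≡⟨ sym (map-++ f (L.reverse (lookup sd o)) _) ⟩
      L.map f (line p) ∎)) (last-map f (line p))
      where
      open ≡-Reasoning
      f = σ ⟨$⟩ʳ_
    reverse-short : ∀ (u : List (Fin w)) → length u ≤ 1 → L.reverse u ≡ u
    reverse-short [] _ = refl
    reverse-short (x ∷ []) _ = refl
    reverse-short (x ∷ y ∷ u) (s≤s ())
    -- A headshunt with at most one wagon equals its own reversal, so it may be grouped with either
    -- siding. Hence moves on `o` preserve the line just as those on `z` do.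
    line-alt : ∀ p → Valid 1 m p → line p ≡ L.reverse (headshunt p ++ siding p o) ++ siding p z
    line-alt (hs , sd) (_ , lh , _) = ≡-trans (sym (++-assoc (L.reverse (lookup sd o)) hs (lookup sd z)))
      (cong (_++ lookup sd z) (≡-trans (cong (L.reverse (lookup sd o) ++_) (sym (reverse-short hs lh)))
        (sym (reverse-++ hs (lookup sd o)))))
    preserved : ∀ p q → Valid 1 m p → Valid 1 m q → Move p q → inv p ≡ inv q
    preserved p q vp vq (_ , r , same , eq) with r F.≟ z
    ... | yes refl = cong last (cong₂ _++_ (cong L.reverse (same o o≢z)) eq)
    ... | no r≢z with proj₂ (proj₂ (opposite z)) r r≢z
    ...   | refl = cong last (≡-trans (line-alt p vp)
              (≡-trans (cong₂ (λ u v → L.reverse u ++ v) eq (same z (≢-sym r≢z))) (sym (line-alt q vq))))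
    defined : ∀ p → Valid 1 m p → ∃ λ x → inv p ≡ just x
    defined p@(hs , sd) vp = last-defined λ e →
      let rest = ++-conicalʳ (L.reverse (lookup sd o)) _ e in
      nonempty-somewhere m p (<⇒≤ 1<w) vp (++-conicalˡ hs _ rest)
        (empty (≡-trans (sym (reverse-involutive (lookup sd o))) (cong L.reverse (++-conicalˡ (L.reverse (lookup sd o)) _ e))) (++-conicalʳ hs _ rest))
      where
      empty : lookup sd o ≡ [] → lookup sd z ≡ [] → ∀ i → lookup sd i ≡ []
      empty eo ez i with i F.≟ z
      ... | yes refl = ez
      ... | no i≢z = subst (λ k → lookup sd k ≡ []) (sym (proj₂ (proj₂ (opposite z)) i i≢z)) eo
    target : ∀ q → Valid 1 m q → last (siding q z) ≡ just ω → inv q ≡ just ω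
    target (hs , sd) _ e = last-++-just (L.reverse (lookup sd o)) (last-++-just hs e)

-- Necessity of the conditions, and the conclusion.

foldr-⊔-sel : ∀ {n} e (m : Vec ℕ n) → foldr′ _⊔_ e m ≡ e ⊎ ∃ λ j → foldr′ _⊔_ e m ≡ lookup m j
foldr-⊔-sel e [] = inj₁ refl
foldr-⊔-sel e (x ∷ m) with ⊔-sel x (foldr′ _⊔_ e m)
... | inj₁ p = inj₂ (zero , p)
... | inj₂ p with foldr-⊔-sel e m
...   | inj₁ q = inj₁ (≡-trans p q)
...   | inj₂ (j , q) = inj₂ (suc j , ≡-trans p q)

-- The place where the maximum in (∗) is attained selects the invariant. At `h ∸ 1`, failure of (∗)
-- says `sum m < w`; at siding `j` it says `h + sum m ≤ w + lookup m j`, the strict inequality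
-- absorbing the 1 subtracted from `h`.
unstarred : ∀ {w s h} {m : Vec ℕ s} {S F : Config w s → Set} → 1 < w → 1 ≤ h → Natural h m S F →
  ∃[ p ] (Valid h m p × S p) → ¬ Star w h m → ¬ AlwaysSolvable h m S F
unstarred {w} {h = suc h′} {m} 1<w 1≤h natural start ¬star with foldr-⊔-sel h′ m | ≰⇒> ¬star
... | inj₁ e | lt = small-sidings (+-cancelˡ-< h′ _ _ (<-≤-trans lt
        (≤-reflexive (≡-trans (cong (w +_) e) (+-comm w h′)))))
  where open Unsolvable {m = m} 1<w natural start
... | inj₂ (j , e) | lt = large-siding 1≤h j (≤-trans lt (≤-reflexive (cong (w +_) e)))
  where open Unsolvable {m = m} 1<w natural start

-- Beyond `w ≡ 1`, the obstructions exclude one siding, failure of (∗), and `h ≡ 1` with two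
-- sidings; what remains are the solvable cases.
necessary : ∀ {w s h} {m : Vec ℕ s} {S F : Config w s → Set} → 1 ≤ w → 1 ≤ s → 1 ≤ h → Natural h m S F →
  ∃[ p ] (Valid h m p × S p) → AlwaysSolvable h m S F → SolvableCase w s h m
necessary {w} {s} {h} {m} 1≤w 1≤s 1≤h natural start solve
  with w ≟ 1 | s ≟ 1 | (w + maxTerm h m) ≤? (h ∸ 1 + sum m) | h ≟ 1 | s ≟ 2
... | yes w≡1 | _ | _ | _ | _ = inj₂ (inj₂ w≡1)
... | no w≢1 | yes s≡1 | _ | _ | _ = contradiction solve (single-siding s≡1)
  where open Unsolvable {m = m} (≤∧≢⇒< 1≤w (≢-sym w≢1)) natural start
... | no w≢1 | no _ | no ¬star | _ | _ =
  contradiction solve (unstarred (≤∧≢⇒< 1≤w (≢-sym w≢1)) 1≤h natural start ¬star)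
... | no w≢1 | no s≢1 | yes star | no h≢1 | _ =
  inj₁ (≤∧≢⇒< 1≤w (≢-sym w≢1) , ≤∧≢⇒< 1≤s (≢-sym s≢1) , ≤∧≢⇒< 1≤h (≢-sym h≢1) , star)
... | no w≢1 | no _ | yes star | yes h≡1 | yes s≡2 = contradiction solve (two-sidings h≡1 s≡2)
  where open Unsolvable {m = m} (≤∧≢⇒< 1≤w (≢-sym w≢1)) natural start
... | no w≢1 | no s≢1 | yes star | yes h≡1 | no s≢2 =
  inj₂ (inj₁ (≤∧≢⇒< 1≤w (≢-sym w≢1) , ≤∧≢⇒< (≤∧≢⇒< 1≤s (≢-sym s≢1)) (≢-sym s≢2) , h≡1 , star))

theorem1 : (w s h : ℕ) (m : Vec ℕ s) →
    1 ≤ w → 1 ≤ s → 1 ≤ h → All (1 ≤_) m →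
    w < h + sum m →
    (S F : Config w s → Set) →
    Natural h m S F →
    ∃[ p ] (Valid h m p × S p) →
    ∃[ q ] (Valid h m q × F q) →
    (AlwaysSolvable h m S F ⇔ SolvableCase w s h m)
theorem1 w s h m 1≤w 1≤s 1≤h m≥1 w< S F natural start (q , vq , Fq) = mk⇔
  (necessary 1≤w 1≤s 1≤h natural start)
  -- As the inglenook graph is connected, one finishing position serves all starting positions.
  (λ case p vp _ → q , vq , Fq , solvable m 1≤h m≥1 w< case vp vq)
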